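{- Let $\mathcal{P}$ be a bilateral, locally decided, memoryless parking procedure. Then $\widehat{\mathcal{P}}$ is a good correspondence, i.e. for any $(P,Q)$ in the image of $\widehat{\mathcal{P}}$ and any decreasing forest $Q'$ of the same shape as $Q$, $(P,Q')$ is also in the image of $\widehat{\mathcal{P}}$. Moreover, the labeled indexed forests $P$ that occur as first components of elements of the image are exactly those satisfying the following condition: for every node $i$ (identified by its canonical label) with interval $[l_i,r_i]$, the label of $i$ in $P$ belongs to the set $$\{j\in\{l_i,\ldots,i-1\}\mid \mathrm{Dir}_{\mathcal{P}}(\{l_i,\ldots,i-1\},j)=right\}\cup\{i\}\cup\{j\in\{i+1,\ldots,r_i\}\mid \mathrm{Dir}_{\mathcal{P}}(\{i+1,\ldots,r_i\},j)=left\}.$$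
   Context: $\mathbb{Z}^*$ is the set of finite words on $\mathbb{Z}$, $\epsilon$ the empty word, $\mathrm{Fin}(\mathbb{Z})$ the set of finite subsets of $\mathbb{Z}$. A parking procedure is a function $\mathcal{P}:\mathbb{Z}^*\to\mathrm{Fin}(\mathbb{Z})$ with $\mathcal{P}(\epsilon)=\emptyset$ such that for every word $a_1\cdots a_r$ with $r\ge1$: (1) $\#\mathcal{P}(a_1\cdots a_r)=r$ and $\mathcal{P}(a_1\cdots a_i)\subset\mathcal{P}(a_1\cdots a_{i+1})$ for $i<r$; (2) if $a_r\notin\mathcal{P}(a_1\cdots a_{r-1})$ then $\mathcal{P}(a_1\cdots a_r)=\mathcal{P}(a_1\cdots a_{r-1})\sqcup\{a_r\}$. The spot where the $i$th car parks is $\mathrm{ls}_{\mathcal{P}}(a_1\cdots a_i)$, the unique element of $\mathcal{P}(a_1\cdots a_i)\setminus\mathcal{P}(a_1\cdots a_{i-1})$. A block of $S\subset\mathbb{Z}$ is a maximal nonempty interval of consecutive integers contained in $S$. $\mathcal{P}$ is bilateral if whenever $a\in\mathcal{P}(W)$ lies in the block $\{t,\ldots,u\}$ of $\mathcal{P}(W)$, $\mathrm{ls}_{\mathcal{P}}(Wa)\in\{t-1,u+1\}$; then $\mathrm{Dir}_{\mathcal{P}}(Wa)=left$ if $\mathrm{ls}_{\mathcal{P}}(Wa)=t-1$ and $right$ if it is $u+1$. $\mathcal{P}$ is memoryless if there is a function $M_{\mathcal{P}}:\mathrm{Fin}(\mathbb{Z})\times\mathbb{Z}\to\mathbb{Z}$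 such that $\mathcal{P}(Wa)=\mathcal{P}(W)\sqcup\{M_{\mathcal{P}}(\mathcal{P}(W),a)\}$ for all words $W$ and letters $a$; in that case, for $S\in\mathrm{Fin}(\mathbb{Z})$ and $a\in S$, $\mathrm{Dir}_{\mathcal{P}}(S,a)$ denotes the common value of $\mathrm{Dir}_{\mathcal{P}}(Wa)$ for all $W$ with $\mathcal{P}(W)=S$. $\mathcal{P}$ is locally decided if for every word $W$, letter $a$ and block $I$ of $\mathcal{P}(W)$ with $a\in I$, $\mathrm{ls}_{\mathcal{P}}(Wa)=\mathrm{ls}_{\mathcal{P}}(W_{|I}a)$, where $W_{|I}$ is the subword of $W$ formed by the letters of the cars that parked in $I$. The outcome function $\pi_{\mathcal{P}}(W)$ of $W=a_1\cdots a_r$ is the bijection $\mathcal{P}(W)\to\{1,\ldots,r\}$ sending an occupied spot $k$ to the index $i$ such that $\mathrm{ls}_{\mathcal{P}}(a_1\cdots a_i)=k$. A (plane) binary tree is either empty or a node with a left and a right binary subtree; its size is its number of nodes. An indexed forest is the data of a finite set $S\subset\mathbb{Z}$ (its support) and, for each block $I$ of $S$, a binary tree of size $|I|$. Its canonical labeling labels, for each block $I$, the nodes of the corresponding tree by the elements of $I$ increasingly in in-order (left subtree, root, right subtree); nodes are thereby identified with elements of $S$. The interval $[l_i,r_i]$ of a node $i$ is the interval formed by the canonical labels of all nodes of the subtree rooted at $i$ (including $i$). A decreasing forest is an indexed forest with $r$ nodes labeled bijectively by $\{1,\ldots,r\}$ so that each node has a larger label than all its descendants. Given $W=a_1\cdots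 a_r$, $\widehat{\mathcal{P}}(W)=(P,Q)$ is the pair of labeled indexed forests of the same shape defined as follows: $Q$ is the unique decreasing forest with support $\mathcal{P}(W)$ whose node with canonical label $i$ has label $q_i=\pi_{\mathcal{P}}(W)(i)$ (on each block, the root is the position of the maximum value, and the left and right subtrees are constructed recursively from the positions to the left and right of it); $P$ is the same indexed forest with node $i$ labeled by $p_i=a_{q_i}\in\mathbb{Z}$. -}

module Defs where

open import Data.Fin using (Fin; toℕ)
open import Data.Integer as ℤ using (ℤ; +_)
import Data.Integer.Properties as ℤ
open import Data.List using (List; []; _∷_; _∷ʳ_; _++_; length; map; filter; take; lookup; allFin; applyUpTo)
open import Data.List.Membership.Propositional using (find)
  renaming (_∈_ to _∈ₗ_)
open import Data.List.Membership.Propositional.Properties using (∈-∃++; ∈-++⁻; ∈-++⁺ˡ; ∈-++⁺ʳ)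
open import Data.List.Membership.DecPropositional ℤ._≟_ using () renaming (_∈?_ to _∈ₗ?_)
open import Data.List.Properties using (length-++-comm)
open import Data.List.Relation.Unary.All as All using (All; []; _∷_)
open import Data.List.Relation.Unary.All.Properties using (¬All⇒Any¬; All¬⇒¬Any; ¬Any⇒All¬)
open import Data.List.Relation.Unary.AllPairs as AllPairs using (AllPairs; []; _∷_)
import Data.List.Relation.Unary.AllPairs.Properties as AllPairs
open import Data.List.Relation.Unary.Any using (here; there)
open import Data.List.Relation.Unary.Unique.Propositional using (Unique)
open import Data.Nat as ℕ using (ℕ; suc; s≤s; z≤n)
import Data.Nat.Properties as ℕ
open import Data.Product using (_×_; _,_; ∃; ∃₂; ∃!; proj₁; proj₂)
open import Data.Sum using (_⊎_; inj₁; inj₂)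
open import Data.Tree.Binary using (Tree; leaf; node; #nodes; module Infix)
open import Data.Unit using (⊤)
open import Function using (_⇔_)
open import Relation.Binary.PropositionalEquality using (_≡_; _≢_; refl; sym; trans; cong)
open import Relation.Nullary using (¬_; Dec; yes; no; contradiction)
open import Relation.Nullary.Decidable using (recompute)

-- A finite set is its strictly increasing enumeration, so that finite sets with
-- the same elements are propositionally equal.
record Finℤ : Set where
  constructor mkFinℤ
  field
    elements    : List ℤ
    .increasing : AllPairs ℤ._<_ elements

open Finℤ public

infix 4 _∈_ _∈?_ _⊆_

_∈_ : ℤ → Finℤ → Set
x ∈ S = x ∈ₗ elements S

_∈?_ : ∀ x S → Dec (x ∈ S)
x ∈? S = x ∈ₗ? elements S

_⊆_ : Finℤ → Finℤ → Set
S ⊆ T = ∀ {x} → x ∈ S → x ∈ T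

∅ : Finℤ
∅ = mkFinℤ [] []

∣_∣ : Finℤ → ℕ
∣ S ∣ = length (elements S)

-- {t, …, u}, which is empty when u < t.
[_⋯_] : ℤ → ℤ → Finℤ
[ t ⋯ u ] = mkFinℤ
  (applyUpTo (λ n → t ℤ.+ + n) ℤ.∣ (ℤ.suc u ℤ.- t) ℤ.⊔ + 0 ∣)
  (AllPairs.applyUpTo⁺₁ _ _ λ i<j _ → ℤ.+-monoʳ-< t (ℤ.+<+ i<j))

infix 4 _≐_⊔｛_｝

_≐_⊔｛_｝ : Finℤ → Finℤ → ℤ → Set
T ≐ S ⊔｛ x ｝ = ¬ x ∈ S × (∀ y → y ∈ T ⇔ (y ∈ S ⊎ y ≡ x))

-- The bounds are unique because the interval is nonempty, so a block is
-- represented by the pair (t , u).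
record IsBlock (S : Finℤ) (t u : ℤ) : Set where
  field
    nonempty : t ℤ.≤ u
    included : [ t ⋯ u ] ⊆ S
    maximal  : ∀ t′ u′ → [ t ⋯ u ] ⊆ [ t′ ⋯ u′ ] → [ t′ ⋯ u′ ] ⊆ S → [ t′ ⋯ u′ ] ⊆ [ t ⋯ u ]

Word : Set
Word = List ℤ

-- Words are read from left to right, so the word Wa is W ∷ʳ a.
record ParkingProcedure : Set where
  field
    park      : Word → Finℤ
    park-ε    : park [] ≡ ∅
    size      : ∀ W → ∣ park W ∣ ≡ length W
    extends   : ∀ W a → park W ⊆ park (W ∷ʳ a)
    free-spot : ∀ W a → ¬ a ∈ park W → park (W ∷ʳ a) ≐ park W ⊔｛ a ｝

private
  pigeonhole : ∀ {xs ys : List ℤ} → Unique xs → (∀ {x} → x ∈ₗ xs → x ∈ₗ ys) → length xs ℕ.≤ length ys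
  pigeonhole {[]} _ _ = z≤n
  pigeonhole {x ∷ xs} (x∉xs ∷ xs!) xs⊆ys with ∈-∃++ (xs⊆ys (here refl))
  ... | as , bs , refl = ℕ.≤-trans (s≤s (pigeonhole xs! xs⊆as++bs))
                                   (ℕ.≤-reflexive (sym (trans (length-++-comm as (x ∷ bs)) (cong suc (length-++-comm bs as)))))
    where
    xs⊆as++bs : ∀ {y} → y ∈ₗ xs → y ∈ₗ as ++ bs
    xs⊆as++bs y∈xs with ∈-++⁻ as (xs⊆ys (there y∈xs))
    ... | inj₁ y∈as         = ∈-++⁺ˡ y∈as
    ... | inj₂ (here refl)  = contradiction y∈xs (All¬⇒¬Any x∉xs)
    ... | inj₂ (there y∈bs) = ∈-++⁺ʳ as y∈bs

  distinct : ∀ S → Unique (elements S)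
  distinct (mkFinℤ xs xs↗) = AllPairs.map ℤ.<⇒≢ (recompute (AllPairs.allPairs? ℤ._<?_ xs) xs↗)

data Direction : Set where
  left right : Direction

module _ (𝒫 : ParkingProcedure) where
  open ParkingProcedure 𝒫

  newSpot : ∀ W a → ∃! _≡_ λ k → k ∈ park (W ∷ʳ a) × ¬ k ∈ park W
  newSpot W a with All.all? (_∈? park W) (elements (park (W ∷ʳ a)))
  ... | yes all∈ = contradiction (pigeonhole (distinct (park (W ∷ʳ a))) (All.lookup all∈)) (ℕ.<⇒≱ grows)
    where
    grows : ∣ park W ∣ ℕ.< ∣ park (W ∷ʳ a) ∣
    grows = ℕ.≤-reflexive (trans (cong suc (size W)) (trans (length-++-comm (a ∷ []) W) (sym (size (W ∷ʳ a)))))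
  ... | no ¬all∈ with find (¬All⇒Any¬ (_∈? park W) _ ¬all∈)
  ...   | k , k∈ , k∉ = k , (k∈ , k∉) , unique
    where
    tooMany : ∀ {y} → y ∈ park (W ∷ʳ a) → ¬ y ∈ park W → k ≢ y → suc (suc (length W)) ℕ.≤ suc (length W)
    tooMany {y} y∈ y∉ k≢y = count (pigeonhole {k ∷ y ∷ elements (park W)}
        ((k≢y ∷ ¬Any⇒All¬ _ k∉) ∷ ¬Any⇒All¬ _ y∉ ∷ distinct (park W)) sub)
      where
      sub : ∀ {x} → x ∈ₗ k ∷ y ∷ elements (park W) → x ∈ park (W ∷ʳ a)
      sub (here refl)         = k∈
      sub (there (here refl)) = y∈
      sub (there (there x∈))  = extends W a x∈
      count : suc (suc ∣ park W ∣) ℕ.≤ ∣ park (W ∷ʳ a) ∣ → suc (suc (length W)) ℕ.≤ suc (length W)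
      count rewrite size W | size (W ∷ʳ a) | length-++-comm W (a ∷ []) = λ p → p
    unique : ∀ {y} → y ∈ park (W ∷ʳ a) × ¬ y ∈ park W → k ≡ y
    unique {y} (y∈ , y∉) with k ℤ.≟ y
    ... | yes k≡y = k≡y
    ... | no  k≢y = contradiction (tooMany y∈ y∉ k≢y) (ℕ.<⇒≱ ℕ.≤-refl)

  -- The spot where the last car of the word Wa parks.
  ls : Word → ℤ → ℤ
  ls W a = proj₁ (newSpot W a)

  -- spot W j is where the car of index j + 1 parks.
  spot : ∀ W → Fin (length W) → ℤ
  spot W j = ls (take (toℕ j) W) (lookup W j)

  _restrictedTo_ : Word → Finℤ → Word
  W restrictedTo I = map (lookup W) (filter (λ j → spot W j ∈? I) (allFin (length W)))

  Bilateral : Set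
  Bilateral = ∀ W a t u → IsBlock (park W) t u → a ∈ [ t ⋯ u ] →
              ls W a ≡ ℤ.pred t ⊎ ls W a ≡ ℤ.suc u

  Memoryless : Set
  Memoryless = ∃ λ (M : Finℤ → ℤ → ℤ) →
               ∀ W a → park (W ∷ʳ a) ≐ park W ⊔｛ M (park W) a ｝

  LocallyDecided : Set
  LocallyDecided = ∀ W a t u → IsBlock (park W) t u → a ∈ [ t ⋯ u ] →
                   ls W a ≡ ls (W restrictedTo [ t ⋯ u ]) a

  -- Dir W a d says that Dir(Wa) is defined and equal to d.
  Dir : Word → ℤ → Direction → Set
  Dir W a left  = ∃₂ λ t u → IsBlock (park W) t u × a ∈ [ t ⋯ u ] × ls W a ≡ ℤ.pred t
  Dir W a right = ∃₂ λ t u → IsBlock (park W) t u × a ∈ [ t ⋯ u ] × ls W a ≡ ℤ.suc u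

  -- d is the common value of Dir(Wa) over the (nonempty) set of words W with
  -- 𝒫(W) = S.
  DirSet : Finℤ → ℤ → Direction → Set
  DirSet S a d = (∃ λ W → park W ≡ S) × (∀ W → park W ≡ S → Dir W a d)

  -- Outcome W k n says that π(W)(k) = n, the cars being numbered from 1.
  Outcome : Word → ℤ → ℕ → Set
  Outcome W k n = ∃ λ j → spot W j ≡ k × n ≡ suc (toℕ j)

-- LetterAt W n a says that a is the n-th letter of W, counting from 1.
LetterAt : Word → ℕ → ℤ → Set
LetterAt W n a = ∃ λ j → n ≡ suc (toℕ j) × a ≡ lookup W j

BinaryTree : Set
BinaryTree = Tree ⊤ ⊤

-- The proof of IsBlock is irrelevant so that each block carries a single tree.
record IndexedForest : Set where
  field
    support   : Finℤ
    tree      : ∀ t u → .(IsBlock support t u) → BinaryTree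
    tree-size : ∀ t u .(b : IsBlock support t u) → #nodes (tree t u b) ≡ ∣ [ t ⋯ u ] ∣

open IndexedForest public

infix 4 _≈_ _⊑_

-- Equality of indexed forests.
_≈_ : IndexedForest → IndexedForest → Set
F ≈ G = support F ≡ support G ×
        (∀ t u .(b : IsBlock (support F) t u) .(c : IsBlock (support G) t u) → tree F t u b ≡ tree G t u c)

-- In-order labeling by consecutive integers starting from t.
inOrder : ℤ → BinaryTree → Tree ℤ ⊤
inOrder t (leaf _)     = leaf _
inOrder t (node L _ R) = node (inOrder t L) i (inOrder (ℤ.suc i) R)
  where
  i : ℤ
  i = t ℤ.+ + #nodes L

canonical : (F : IndexedForest) → ∀ t u → .(IsBlock (support F) t u) → Tree ℤ ⊤
canonical F t u b = inOrder t (tree F t u b)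

-- s ⊑ T says that s is the subtree of T rooted at some node (or empty position) of T.
data _⊑_ (s : Tree ℤ ⊤) : Tree ℤ ⊤ → Set where
  root   : s ⊑ s
  leftᵗ  : ∀ {L i R} → s ⊑ L → s ⊑ node L i R
  rightᵗ : ∀ {L i R} → s ⊑ R → s ⊑ node L i R

HasInterval : Tree ℤ ⊤ → ℤ → ℤ → Set
HasInterval s l r = ∀ k → k ∈ₗ Infix.toList s ⇔ k ∈ [ l ⋯ r ]

-- Nodes are identified with elements of the support, through the canonical labeling.
record LabeledForest (A : Set) : Set where
  field
    shape : IndexedForest
    label : ∀ i → .(i ∈ support shape) → A

open LabeledForest public

record IsDecreasing (Q : LabeledForest ℕ) : Set where
  private
    S : Finℤ
    S = support (shape Q)
  field
    range      : ∀ i .(h : i ∈ S) → 1 ℕ.≤ label Q i h × label Q i h ℕ.≤ ∣ S ∣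
    injective  : ∀ i j .(h : i ∈ S) .(k : j ∈ S) → label Q i h ≡ label Q j k → i ≡ j
    surjective : ∀ n → 1 ℕ.≤ n → n ℕ.≤ ∣ S ∣ → ∃ λ i → ∃ λ (h : i ∈ S) → label Q i h ≡ n
    decreasing : ∀ t u .(b : IsBlock S t u) {L i R} → node L i R ⊑ canonical (shape Q) t u b →
                 ∀ j → j ∈ₗ Infix.toList L ⊎ j ∈ₗ Infix.toList R →
                 .(h : i ∈ S) .(k : j ∈ S) → label Q j k ℕ.< label Q i h

module _ (𝒫 : ParkingProcedure) where
  open ParkingProcedure 𝒫

  -- The graph of the correspondence: the word W is sent to the pair (P , Q).
  record _↦_,_ (W : Word) (P : LabeledForest ℤ) (Q : LabeledForest ℕ) : Set where
    field
      Q-decreasing : IsDecreasing Q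
      Q-support    : support (shape Q) ≡ park W
      Q-label      : ∀ i .(h : i ∈ support (shape Q)) → Outcome 𝒫 W i (label Q i h)
      same-shape   : shape P ≈ shape Q
      P-label      : ∀ i .(h : i ∈ support (shape P)) .(k : i ∈ support (shape Q)) →
                     LetterAt W (label Q i k) (label P i h)

  InImage : LabeledForest ℤ → LabeledForest ℕ → Set
  InImage P Q = ∃ λ W → W ↦ P , Q

  GoodCorrespondence : Set
  GoodCorrespondence = ∀ P Q Q′ → InImage P Q → IsDecreasing Q′ → shape Q ≈ shape Q′ → InImage P Q′

  Allowed : (l i r a : ℤ) → Set
  Allowed l i r a =
    (a ∈ [ l ⋯ ℤ.pred i ] × DirSet 𝒫 [ l ⋯ ℤ.pred i ] a right) ⊎
    a ≡ i ⊎
    (a ∈ [ ℤ.suc i ⋯ r ] × DirSet 𝒫 [ ℤ.suc i ⋯ r ] a left)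

  LabelCondition : LabeledForest ℤ → Set
  LabelCondition P =
    ∀ t u .(b : IsBlock (support (shape P)) t u) {L i R} → node L i R ⊑ canonical (shape P) t u b →
    ∀ l r → HasInterval (node L i R) l r →
    .(h : i ∈ support (shape P)) → Allowed l i r (label P i h)

{-# OPTIONS --safe #-}
-- Memorylessness gives 𝒫 a step function M, and applying the hypotheses to the
-- word that lists the elements of S, in which every car parks on its own letter,
-- turns local decision into: M S a = M I a whenever a lies in the block I of S.
-- Given a decreasing labeling, let X be the set of nodes whose label is smaller
-- than that of a node i with interval [l, r].  All of [l, r] except i lies in X,
-- while l - 1 and r + 1 do not, being ancestors of i or outside the support.  So
-- the car that parks at i finds the blocks {l, …, i-1} and {i+1, …, r} around i,
-- and its letters are exactly those of the condition.  The condition depends on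
-- the shape only, hence any decreasing labeling of that shape can be realised.
module Submission where

open import Defs
open import Data.Fin as Fin using (Fin; toℕ)
import Data.Fin.Properties as Fin
open import Data.Integer as ℤ using (ℤ; +_)
import Data.Integer.Properties as ℤ
open import Data.Integer.Tactic.RingSolver using (solve-∀)
open import Data.List using (List; []; _∷_; _∷ʳ_; _++_; length; map; filter; take; drop; lookup; allFin; applyUpTo)
open import Data.List.Extrema.Nat using (max; xs≤max)
open import Data.List.Membership.Propositional using () renaming (_∈_ to _∈ₗ_; _∉_ to _∉ₗ_)
open import Data.List.Membership.Propositional.Properties
  using (∈-++⁺ˡ; ∈-++⁺ʳ; ∈-++⁻; ∈-map⁺; ∈-map⁻; ∈-filter⁺; ∈-filter⁻; ∈-applyUpTo⁺; ∈-applyUpTo⁻; ∈-lookup; ∈-allFin)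
open import Data.List.Properties
  using (++-assoc; ++-identityʳ; take-suc; take-take; take++drop≡id; length-applyUpTo; applyUpTo-∷ʳ;
         lookup-applyUpTo; filter-notAll)
open import Data.List.Relation.Unary.All as All using (All; []; _∷_)
open import Data.List.Relation.Unary.AllPairs as AllPairs using (AllPairs; []; _∷_)
import Data.List.Relation.Unary.Any as Any
open import Data.List.Relation.Unary.Any using (here; there; index)
open import Data.List.Relation.Unary.Any.Properties using (lookup-index)
open import Data.List.Relation.Unary.Unique.Propositional using (Unique)
import Data.List.Relation.Unary.Unique.Propositional.Properties as Unique
open import Data.Nat as ℕ using (ℕ; zero; suc; z≤n; s≤s)
import Data.Nat.Properties as ℕ
open import Data.Product using (_×_; _,_; ∃; ∃₂; proj₁; proj₂)
open import Data.Product.Relation.Binary.Lex.Strict using (×-strictTotalOrder)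
open import Data.Sum using (_⊎_; inj₁; inj₂; [_,_]′)
open import Data.Tree.Binary using (Tree; leaf; node; #nodes; module Infix)
open import Data.Unit using (⊤)
open import Function using (_⇔_; mk⇔; _∘_; Equivalence)
open import Relation.Binary using (StrictTotalOrder; tri<; tri≈; tri>)
open import Relation.Binary.PropositionalEquality
  using (_≡_; _≢_; refl; sym; trans; cong; cong₂; subst; subst₂; module ≡-Reasoning)
open import Relation.Nullary using (¬_; Dec; yes; no; contradiction)
open import Relation.Nullary.Decidable using (recompute; map′; ¬?; _×-dec_)
open import Relation.Unary using (Decidable)

open Equivalence using (to; from)

-- Blocks of finite sets of integers

-- The field `increasing` is irrelevant, so a usable proof is rebuilt by deciding the property on
-- the list.
elements-increasing : ∀ S → AllPairs ℤ._<_ (elements S)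
elements-increasing (mkFinℤ xs xs↗) = recompute (AllPairs.allPairs? ℤ._<?_ xs) xs↗

elements-unique : ∀ S → Unique (elements S)
elements-unique S = AllPairs.map ℤ.<⇒≢ (elements-increasing S)

-- The head of an increasing list is its minimum. If the heads differed, each would occur in the
-- other tail and so exceed the other.
increasing-ext : ∀ {xs ys} → AllPairs ℤ._<_ xs → AllPairs ℤ._<_ ys →
                 (∀ x → x ∈ₗ xs ⇔ x ∈ₗ ys) → xs ≡ ys
increasing-ext {[]} {[]} _ _ _ = refl
increasing-ext {[]} {y ∷ ys} _ _ eq = contradiction (from (eq y) (here refl)) λ ()
increasing-ext {x ∷ xs} {[]} _ _ eq = contradiction (to (eq x) (here refl)) λ ()
increasing-ext {x ∷ xs} {y ∷ ys} (x< ∷ xs↗) (y< ∷ ys↗) eq = cong₂ _∷_ x≡y (increasing-ext xs↗ ys↗ tails)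
  where
  x≡y : x ≡ y
  x≡y with to (eq x) (here refl) | from (eq y) (here refl)
  ... | here x≡y | _ = x≡y
  ... | there _ | here y≡x = sym y≡x
  ... | there x∈ys | there y∈xs = contradiction (All.lookup x< y∈xs) (ℤ.<-asym (All.lookup y< x∈ys))

  tails : ∀ z → z ∈ₗ xs ⇔ z ∈ₗ ys
  tails z = mk⇔ (λ z∈ → strip (All.lookup x< z∈) x≡y (to (eq z) (there z∈)))
                (λ z∈ → strip (All.lookup y< z∈) (sym x≡y) (from (eq z) (there z∈)))
    where
    strip : ∀ {a b zs} → a ℤ.< z → a ≡ b → z ∈ₗ b ∷ zs → z ∈ₗ zs
    strip a<z refl (here refl) = contradiction a<z (ℤ.<-irrefl refl)
    strip a<z _    (there z∈)  = z∈

-- Once the lists agree, the irrelevant proofs of monotonicity agree by definition. This turns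
-- membership statements into the equations `park W ≡ S` that memorylessness requires.
Finℤ-ext : ∀ S T → (∀ x → x ∈ S ⇔ x ∈ T) → S ≡ T
Finℤ-ext S@(mkFinℤ _ _) T@(mkFinℤ _ _) eq
  with refl ← increasing-ext (elements-increasing S) (elements-increasing T) eq = refl

<suc⇒≤ : ∀ {i j} → i ℤ.< ℤ.suc j → i ℤ.≤ j
<suc⇒≤ {i} {j} i<1+j = subst (i ℤ.≤_) (ℤ.pred-suc j) (ℤ.i<j⇒i≤pred[j] i<1+j)

≤⇒<suc : ∀ {i j} → i ℤ.≤ j → i ℤ.< ℤ.suc j
≤⇒<suc i≤j = ℤ.suc[i]≤j⇒i<j (ℤ.suc-mono i≤j)

pred-< : ∀ i → ℤ.pred i ℤ.< i
pred-< i = ℤ.i≤pred[j]⇒i<j ℤ.≤-refl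

<-suc : ∀ i → i ℤ.< ℤ.suc i
<-suc i = ≤⇒<suc ℤ.≤-refl

+-cancelˡ-≤ : ∀ i {j k} → i ℤ.+ j ℤ.≤ i ℤ.+ k → j ℤ.≤ k
+-cancelˡ-≤ i i+j≤i+k = ℤ.≮⇒≥ λ k<j → ℤ.<⇒≱ (ℤ.+-monoʳ-< i k<j) i+j≤i+k

+-cancelˡ-< : ∀ i {j k} → i ℤ.+ j ℤ.< i ℤ.+ k → j ℤ.< k
+-cancelˡ-< i i+j<i+k = ℤ.≰⇒> λ k≤j → ℤ.<⇒≱ i+j<i+k (ℤ.+-monoʳ-≤ i k≤j)

-- The quantity `∣ i ⊔ 0 ∣` is the length in the definition of `[_⋯_]`, where negative widths are
-- cut off at zero.
n<∣i⊔0∣⇒n<i : ∀ {n} i → n ℕ.< ℤ.∣ i ℤ.⊔ + 0 ∣ → + n ℤ.< i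
n<∣i⊔0∣⇒n<i {n} (+ m) n<m = ℤ.+<+ (subst (n ℕ.<_) (ℕ.⊔-identityʳ m) n<m)

n<i⇒n<∣i⊔0∣ : ∀ {n i} → + n ℤ.< i → n ℕ.< ℤ.∣ i ℤ.⊔ + 0 ∣
n<i⇒n<∣i⊔0∣ {n} {+ m} (ℤ.+<+ n<m) = subst (n ℕ.<_) (sym (ℕ.⊔-identityʳ m)) n<m

i+[j-i]≡j : ∀ i j → i ℤ.+ (j ℤ.- i) ≡ j
i+[j-i]≡j = solve-∀

≤⇒∃+ : ∀ {i j} → i ℤ.≤ j → ∃ λ n → j ≡ i ℤ.+ + n
≤⇒∃+ {i} {j} i≤j = ℤ.∣ j ℤ.- i ∣ ,
  sym (trans (cong (λ k → i ℤ.+ k) (ℤ.0≤i⇒+∣i∣≡i (ℤ.i≤j⇒0≤j-i i≤j))) (i+[j-i]≡j i j))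

∈-interval⁻ : ∀ {k} t u → k ∈ [ t ⋯ u ] → t ℤ.≤ k × k ℤ.≤ u
∈-interval⁻ t u k∈ with n , n< , refl ← ∈-applyUpTo⁻ (λ n → t ℤ.+ + n) k∈ =
  ℤ.i≤i+j t (+ n) ,
  <suc⇒≤ (subst (t ℤ.+ + n ℤ.<_) (i+[j-i]≡j t (ℤ.suc u)) (ℤ.+-monoʳ-< t (n<∣i⊔0∣⇒n<i _ n<)))

∈-interval⁺ : ∀ {k} t u → t ℤ.≤ k → k ℤ.≤ u → k ∈ [ t ⋯ u ]
∈-interval⁺ t u t≤k k≤u with n , refl ← ≤⇒∃+ t≤k =
  ∈-applyUpTo⁺ (λ n → t ℤ.+ + n) (n<i⇒n<∣i⊔0∣ (+-cancelˡ-< t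
    (subst (t ℤ.+ + n ℤ.<_) (sym (i+[j-i]≡j t (ℤ.suc u))) (≤⇒<suc k≤u))))

∉-pred-interval : ∀ t u → ¬ ℤ.pred t ∈ [ t ⋯ u ]
∉-pred-interval t u p = ℤ.<⇒≱ (pred-< t) (proj₁ (∈-interval⁻ t u p))

∉-suc-interval : ∀ t u → ¬ ℤ.suc u ∈ [ t ⋯ u ]
∉-suc-interval t u p = ℤ.<⇒≱ (<-suc u) (proj₂ (∈-interval⁻ t u p))

-- Maximality is tested at the two neighbouring spots only, in place of a quantification over all
-- larger intervals. This makes blocks decidable and easy to construct.
record MaximalRun (S : Finℤ) (t u : ℤ) : Set where
  constructor mkRun
  field
    nonempty : t ℤ.≤ u
    included : [ t ⋯ u ] ⊆ S
    pred∉    : ¬ ℤ.pred t ∈ S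
    suc∉     : ¬ ℤ.suc u ∈ S

module _ {S : Finℤ} {t u : ℤ} where

  -- A neighbour in `S` would extend the block by one spot, against maximality.
  block⇒run : IsBlock S t u → MaximalRun S t u
  block⇒run b = mkRun nonempty included
    (λ p → ∉-pred-interval t u (maximal (ℤ.pred t) u
      (λ x∈ → ∈-interval⁺ _ u (ℤ.≤-trans (ℤ.<⇒≤ (pred-< t)) (proj₁ (∈-interval⁻ t u x∈))) (proj₂ (∈-interval⁻ t u x∈)))
      (λ {x} x∈ → [ (λ t≤x → included (∈-interval⁺ t u t≤x (proj₂ (∈-interval⁻ _ u x∈))))
                  , (λ x<t → subst (_∈ S) (ℤ.≤-antisym (proj₁ (∈-interval⁻ _ u x∈)) (ℤ.i<j⇒i≤pred[j] x<t)) p) ]′ (≤∨> t x))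
      (∈-interval⁺ _ u ℤ.≤-refl (ℤ.≤-trans (ℤ.<⇒≤ (pred-< t)) nonempty))))
    (λ p → ∉-suc-interval t u (maximal t (ℤ.suc u)
      (λ x∈ → ∈-interval⁺ t _ (proj₁ (∈-interval⁻ t u x∈)) (ℤ.≤-trans (proj₂ (∈-interval⁻ t u x∈)) (ℤ.<⇒≤ (<-suc u))))
      (λ {x} x∈ → [ (λ x≤u → included (∈-interval⁺ t u (proj₁ (∈-interval⁻ t (ℤ.suc u) x∈)) x≤u))
                  , (λ u<x → subst (_∈ S) (ℤ.≤-antisym (ℤ.i<j⇒suc[i]≤j u<x) (proj₂ (∈-interval⁻ t (ℤ.suc u) x∈))) p) ]′ (≤∨> x u))
      (∈-interval⁺ t _ (ℤ.≤-trans nonempty (ℤ.<⇒≤ (<-suc u))) ℤ.≤-refl)))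
    where
    open IsBlock b
    ≤∨> : ∀ i j → i ℤ.≤ j ⊎ j ℤ.< i
    ≤∨> i j with i ℤ.≤? j
    ... | yes i≤j = inj₁ i≤j
    ... | no  i≰j = inj₂ (ℤ.≰⇒> i≰j)

  run⇒block : MaximalRun S t u → IsBlock S t u
  run⇒block (mkRun t≤u included pred∉ suc∉) = record
    { nonempty = t≤u
    ; included = included
    ; maximal  = λ t′ u′ ⊆′ ⊆S {x} x∈ →
        let t′≤x , x≤u′ = ∈-interval⁻ t′ u′ x∈
            t′≤t , t≤u′ = ∈-interval⁻ t′ u′ (⊆′ (∈-interval⁺ t u ℤ.≤-refl t≤u))
            t′≤u , u≤u′ = ∈-interval⁻ t′ u′ (⊆′ (∈-interval⁺ t u t≤u ℤ.≤-refl))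
        in ∈-interval⁺ t u
             (ℤ.≮⇒≥ λ x<t → pred∉ (⊆S (∈-interval⁺ t′ u′ (ℤ.≤-trans t′≤x (ℤ.i<j⇒i≤pred[j] x<t))
                                        (ℤ.≤-trans (ℤ.<⇒≤ (pred-< t)) t≤u′))))
             (ℤ.≮⇒≥ λ u<x → suc∉ (⊆S (∈-interval⁺ t′ u′ (ℤ.≤-trans t′≤u (ℤ.<⇒≤ (<-suc u)))
                                       (ℤ.≤-trans (ℤ.i<j⇒suc[i]≤j u<x) x≤u′))))
    }

-- Allows block proofs to be recomputed where the forests supply them only irrelevantly.
isBlock? : ∀ S t u → Dec (IsBlock S t u)
isBlock? S t u = map′
  (λ (t≤u , ⊆S , p , s) → run⇒block (mkRun t≤u (All.lookup ⊆S) p s))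
  (λ b → let open MaximalRun (block⇒run b) in nonempty , All.tabulate included , pred∉ , suc∉)
  (t ℤ.≤? u ×-dec All.all? (_∈? S) _ ×-dec ¬? (ℤ.pred t ∈? S) ×-dec ¬? (ℤ.suc u ∈? S))

-- If one run began strictly below the other, it would contain the spot just before the later start,
-- which is not in `S`. The upper ends are compared in the same way.
runs-meet : ∀ {S t u t′ u′ x} → MaximalRun S t u → MaximalRun S t′ u′ →
            x ∈ [ t ⋯ u ] → x ∈ [ t′ ⋯ u′ ] → t ≡ t′ × u ≡ u′
runs-meet r r′ x∈ x∈′ = ℤ.≤-antisym (lower r′ r x∈′ x∈) (lower r r′ x∈ x∈′) ,
                        ℤ.≤-antisym (upper r r′ x∈ x∈′) (upper r′ r x∈′ x∈)
  where
  open MaximalRun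
  lower : ∀ {S t u t′ u′ x} → MaximalRun S t u → MaximalRun S t′ u′ →
          x ∈ [ t ⋯ u ] → x ∈ [ t′ ⋯ u′ ] → t′ ℤ.≤ t
  lower {t = t} {u} {t′} {u′} r r′ x∈ x∈′ = ℤ.≮⇒≥ λ t<t′ → pred∉ r′ (included r (∈-interval⁺ t u (ℤ.i<j⇒i≤pred[j] t<t′)
    (ℤ.≤-trans (ℤ.<⇒≤ (pred-< t′)) (ℤ.≤-trans (proj₁ (∈-interval⁻ t′ u′ x∈′)) (proj₂ (∈-interval⁻ t u x∈))))))
  upper : ∀ {S t u t′ u′ x} → MaximalRun S t u → MaximalRun S t′ u′ →
          x ∈ [ t ⋯ u ] → x ∈ [ t′ ⋯ u′ ] → u ℤ.≤ u′
  upper {t = t} {u} {t′} {u′} r r′ x∈ x∈′ = ℤ.≮⇒≥ λ u′<u → suc∉ r′ (included r (∈-interval⁺ t u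
    (ℤ.≤-trans (ℤ.≤-trans (proj₁ (∈-interval⁻ t u x∈)) (proj₂ (∈-interval⁻ t′ u′ x∈′))) (ℤ.<⇒≤ (<-suc u′)))
    (ℤ.i<j⇒suc[i]≤j u′<u)))

interval-run : ∀ {t u} → t ℤ.≤ u → MaximalRun [ t ⋯ u ] t u
interval-run {t} {u} t≤u = mkRun t≤u (λ x∈ → x∈) (∉-pred-interval t u) (∉-suc-interval t u)

-- The intervals [ l ⋯ i - 1 ] and [ i + 1 ⋯ r ] are blocks of X, unless they are empty.
record MaximalGap (X : Finℤ) (l i r : ℤ) : Set where
  field
    l≤i   : l ℤ.≤ i
    i≤r   : i ℤ.≤ r
    gap∉  : ¬ i ∈ X
    below : [ l ⋯ ℤ.pred i ] ⊆ X
    above : [ ℤ.suc i ⋯ r ] ⊆ X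
    pred∉ : ¬ ℤ.pred l ∈ X
    suc∉  : ¬ ℤ.suc r ∈ X

-- The block around an element

lastTrue : ∀ {P : ℕ → Set} → Decidable P → P 0 → ∀ N → ¬ P N →
           ∃ λ n → (∀ m → m ℕ.≤ n → P m) × ¬ P (suc n)
lastTrue P? p zero    ¬p = contradiction p ¬p
lastTrue {P} P? p (suc N) ¬p with P? 1
... | no ¬p₁ = 0 , (λ { _ z≤n → p }) , ¬p₁
... | yes p₁ with n , P≤n , ¬Pn ← lastTrue (P? ∘ suc) p₁ N ¬p =
  suc n , (λ { zero _ → p ; (suc m) (s≤s m≤n) → P≤n m m≤n }) , ¬Pn

module _ (S : Finℤ) (x : ℤ) (x∈S : x ∈ S) where

  private
    radius : ℕ
    radius = suc (max 0 (map (λ y → ℤ.∣ y ℤ.- x ∣) (elements S)))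

    far : ∀ {y} → ℤ.∣ y ℤ.- x ∣ ≡ radius → ¬ y ∈ S
    far eq y∈S = ℕ.<⇒≢ (s≤s (All.lookup (xs≤max 0 _) (∈-map⁺ (λ y → ℤ.∣ y ℤ.- x ∣) y∈S))) eq

    x+k-x : ∀ x k → x ℤ.+ k ℤ.- x ≡ k
    x+k-x = solve-∀

    k-x-k : ∀ x k → x ℤ.- k ℤ.- x ≡ ℤ.- k
    k-x-k = solve-∀

    step⁺ : ∀ x k → x ℤ.+ (+ 1 ℤ.+ k) ≡ + 1 ℤ.+ (x ℤ.+ k)
    step⁺ = solve-∀

    step⁻ : ∀ x k → x ℤ.- (+ 1 ℤ.+ k) ≡ ℤ.- + 1 ℤ.+ (x ℤ.- k)
    step⁻ = solve-∀

    sub-sub : ∀ y m → y ≡ y ℤ.+ m ℤ.- m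
    sub-sub = solve-∀

  -- Walk from `x` in both directions as long as the spots belong to `S`. Both walks stop, because
  -- `radius` exceeds the distance from `x` to every element of `S`.
  run-exists : ∃₂ λ t u → MaximalRun S t u × x ∈ [ t ⋯ u ]
  run-exists
    with a , down , stop⁻ ← lastTrue {λ n → x ℤ.- + n ∈ S} (λ n → _ ∈? S) (subst (_∈ S) (sym (ℤ.+-identityʳ x)) x∈S)
                                     radius (far (trans (cong ℤ.∣_∣ (k-x-k x (+ radius))) (ℤ.∣-i∣≡∣i∣ (+ radius))))
       | b , up , stop⁺ ← lastTrue {λ n → x ℤ.+ + n ∈ S} (λ n → _ ∈? S) (subst (_∈ S) (sym (ℤ.+-identityʳ x)) x∈S)
                                   radius (far (cong ℤ.∣_∣ (x+k-x x (+ radius)))) =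
    x ℤ.- + a , x ℤ.+ + b ,
    mkRun (ℤ.≤-trans below above) inside
          (stop⁻ ∘ subst (_∈ S) (sym (step⁻ x (+ a)))) (stop⁺ ∘ subst (_∈ S) (sym (step⁺ x (+ b)))) ,
    ∈-interval⁺ _ _ below above
    where
    below : x ℤ.- + a ℤ.≤ x
    below = ℤ.i-j≤i x (+ a)
    above : x ℤ.≤ x ℤ.+ + b
    above = ℤ.i≤i+j x (+ b)
    inside : [ x ℤ.- + a ⋯ x ℤ.+ + b ] ⊆ S
    inside {y} y∈ with ∈-interval⁻ _ _ y∈ | ℤ.≤-total x y
    ... | _ , y≤ | inj₁ x≤y with m , refl ← ≤⇒∃+ x≤y = up m (ℤ.drop‿+≤+ (+-cancelˡ-≤ x y≤))
    ... | ≤y , _ | inj₂ y≤x with m , eq ← ≤⇒∃+ y≤x =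
      subst (_∈ S) (sym y≡) (down m (ℤ.drop‿+≤+ (ℤ.neg-cancel-≤ (+-cancelˡ-≤ x (subst (x ℤ.- + a ℤ.≤_) y≡ ≤y)))))
      where
      y≡ : y ≡ x ℤ.- + m
      y≡ = trans (sub-sub y (+ m)) (cong (ℤ._- + m) (sym eq))

-- Parking one car

lookup∉take : ∀ {V : Word} → Unique V → ∀ j → ¬ lookup V j ∈ₗ take (toℕ j) V
lookup∉take {_ ∷ _} (v∉ ∷ _)  (Fin.suc j) (here eq)  = All.lookup v∉ (∈-lookup j) (sym eq)
lookup∉take {_ ∷ _} (_ ∷ V!) (Fin.suc j) (there p) = lookup∉take V! j p

lookup-injective : ∀ {V : Word} → Unique V → ∀ {i j} → lookup V i ≡ lookup V j → i ≡ j
lookup-injective (_ ∷ _)  {Fin.zero}  {Fin.zero}  _  = refl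
lookup-injective (v∉ ∷ _) {Fin.zero}  {Fin.suc j} eq = contradiction eq (All.lookup v∉ (∈-lookup j))
lookup-injective (v∉ ∷ _) {Fin.suc i} {Fin.zero}  eq = contradiction (sym eq) (All.lookup v∉ (∈-lookup i))
lookup-injective (_ ∷ V!) {Fin.suc i} {Fin.suc j} eq = cong Fin.suc (lookup-injective V! eq)

module Parking (𝒫 : ParkingProcedure) where
  open ParkingProcedure 𝒫

  ls-parked : ∀ W a → ls 𝒫 W a ∈ park (W ∷ʳ a)
  ls-parked W a = proj₁ (proj₁ (proj₂ (newSpot 𝒫 W a)))

  ls-free : ∀ W a → ¬ ls 𝒫 W a ∈ park W
  ls-free W a = proj₂ (proj₁ (proj₂ (newSpot 𝒫 W a)))

  ls-unique : ∀ W a {x} → x ∈ park (W ∷ʳ a) → ¬ x ∈ park W → ls 𝒫 W a ≡ x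
  ls-unique W a p q = proj₂ (proj₂ (newSpot 𝒫 W a)) (p , q)

  park-∷ʳ : ∀ W a x → x ∈ park (W ∷ʳ a) ⇔ (x ∈ park W ⊎ x ≡ ls 𝒫 W a)
  park-∷ʳ W a x = mk⇔ split [ extends W a , (λ { refl → ls-parked W a }) ]′
    where
    split : x ∈ park (W ∷ʳ a) → x ∈ park W ⊎ x ≡ ls 𝒫 W a
    split x∈ with x ∈? park W
    ... | yes x∈W = inj₁ x∈W
    ... | no  x∉W = inj₂ (sym (ls-unique W a x∈ x∉W))

  ls-free-spot : ∀ W a → ¬ a ∈ park W → ls 𝒫 W a ≡ a
  ls-free-spot W a a∉ = ls-unique W a (from (proj₂ (free-spot W a a∉) a) (inj₂ refl)) a∉

  ∉park-ε : ∀ {x} → ¬ x ∈ park []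
  ∉park-ε x∈ with () ← subst (_ ∈_) park-ε x∈

  -- Induction on `V′`, with the letters already parked accumulated in `V`. The next letter is new,
  -- so its spot is free and the car takes it.
  park-++-unique : ∀ V V′ → (∀ x → x ∈ park V ⇔ x ∈ₗ V) → (∀ {x} → x ∈ₗ V → x ∉ₗ V′) →
                   Unique V′ → ∀ x → x ∈ park (V ++ V′) ⇔ x ∈ₗ V ++ V′
  park-++-unique V [] eq _ _ x rewrite ++-identityʳ V = eq x
  park-++-unique V (a ∷ V′) eq disj (a∉V′ ∷ V′!) x
    rewrite sym (++-assoc V (a ∷ []) V′) = park-++-unique (V ∷ʳ a) V′ eq′ disj′ V′! x
    where
    a∉ : ¬ a ∈ park V
    a∉ a∈ = disj (to (eq a) a∈) (here refl)
    eq′ : ∀ y → y ∈ park (V ∷ʳ a) ⇔ y ∈ₗ V ∷ʳ a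
    eq′ y = mk⇔
      ([ ∈-++⁺ˡ ∘ to (eq y) , (λ y≡ → ∈-++⁺ʳ V (here (trans y≡ (ls-free-spot V a a∉)))) ]′ ∘ to (park-∷ʳ V a y))
      (from (park-∷ʳ V a y) ∘ [ inj₁ ∘ from (eq y) , (λ { (here y≡a) → inj₂ (trans y≡a (sym (ls-free-spot V a a∉))) ; (there ()) }) ]′ ∘ ∈-++⁻ V)
    disj′ : ∀ {y} → y ∈ₗ V ∷ʳ a → y ∉ₗ V′
    disj′ y∈ y∈V′ with ∈-++⁻ V y∈
    ... | inj₁ y∈V         = disj y∈V (there y∈V′)
    ... | inj₂ (here refl) = All.lookup a∉V′ y∈V′ refl

  park-unique : ∀ {V} → Unique V → ∀ x → x ∈ park V ⇔ x ∈ₗ V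
  park-unique {V} = park-++-unique [] V (λ x → mk⇔ (λ p → contradiction p ∉park-ε) λ ()) λ ()

  spot-unique : ∀ {V} → Unique V → ∀ j → spot 𝒫 V j ≡ lookup V j
  spot-unique {V} V! j = ls-free-spot (take (toℕ j) V) (lookup V j)
    (lookup∉take V! j ∘ to (park-unique (Unique.take⁺ (toℕ j) V!) _))

  -- Every finite set is thus reached by some word, so hypotheses about words transfer to arbitrary
  -- sets.
  park-elements : ∀ S → park (elements S) ≡ S
  park-elements S = Finℤ-ext _ S (park-unique (elements-unique S))

  -- Each car of the enumeration parks on its own letter, so the cars parked in `I` have exactly the
  -- elements of `I` as letters, again without repetition.
  park-elements-restrictedTo : ∀ S I → I ⊆ S → park (_restrictedTo_ 𝒫 (elements S) I) ≡ I
  park-elements-restrictedTo S I I⊆S = Finℤ-ext _ I λ x → mk⇔ (forward x ∘ to (park-unique W! x)) (from (park-unique W! x) ∘ backward x)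
    where
    V : Word
    V = elements S
    V! : Unique V
    V! = elements-unique S
    inI? : Decidable (λ j → spot 𝒫 V j ∈ I)
    inI? j = spot 𝒫 V j ∈? I
    W! : Unique (map (lookup V) (filter inI? (allFin (length V))))
    W! = Unique.map⁺ (lookup-injective V!) (Unique.filter⁺ inI? (Unique.allFin⁺ (length V)))
    forward : ∀ x → x ∈ₗ map (lookup V) (filter inI? (allFin (length V))) → x ∈ I
    forward x x∈ with j , j∈ , refl ← ∈-map⁻ (lookup V) x∈ =
      subst (_∈ I) (spot-unique V! j) (proj₂ (∈-filter⁻ inI? {xs = allFin (length V)} j∈))
    backward : ∀ x → x ∈ I → x ∈ₗ map (lookup V) (filter inI? (allFin (length V)))
    backward x x∈I = subst (_∈ₗ _) (sym x≡) (∈-map⁺ (lookup V)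
      (∈-filter⁺ inI? (∈-allFin j) (subst (_∈ I) (trans x≡ (sym (spot-unique V! j))) x∈I)))
      where
      j : Fin (length V)
      j = index (I⊆S x∈I)
      x≡ : x ≡ lookup V j
      x≡ = lookup-index (I⊆S x∈I)

-- The step function of the procedure

module BilateralLocal (𝒫 : ParkingProcedure) (bilateral : Bilateral 𝒫)
                      (local : LocallyDecided 𝒫) (memoryless : Memoryless 𝒫) where
  open ParkingProcedure 𝒫
  open Parking 𝒫

  M : Finℤ → ℤ → ℤ
  M = proj₁ memoryless

  ls≡M : ∀ W a → ls 𝒫 W a ≡ M (park W) a
  ls≡M W a with ∉W , eq ← proj₂ memoryless W a = ls-unique W a (from (eq _) (inj₂ refl)) ∉W

  ls≡M′ : ∀ {S} W a → park W ≡ S → ls 𝒫 W a ≡ M S a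
  ls≡M′ W a refl = ls≡M W a

  M-free : ∀ S {a} → ¬ a ∈ S → M S a ≡ a
  M-free S {a} a∉S = trans (sym (ls≡M′ (elements S) a (park-elements S)))
    (ls-free-spot (elements S) a (a∉S ∘ subst (a ∈_) (park-elements S)))

  M-bilateral : ∀ {S t u a} → IsBlock S t u → a ∈ [ t ⋯ u ] → M S a ≡ ℤ.pred t ⊎ M S a ≡ ℤ.suc u
  M-bilateral {S} {t} {u} {a} b a∈ = subst (λ x → x ≡ ℤ.pred t ⊎ x ≡ ℤ.suc u) (ls≡M′ (elements S) a (park-elements S))
    (bilateral (elements S) a t u (subst (λ S → IsBlock S t u) (sym (park-elements S)) b) a∈)

  -- Local decision is applied to the enumeration of `S`. The restricted word fills exactly the
  -- block, so memorylessness turns both sides into values of `M`.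
  M-local : ∀ {S t u a} → IsBlock S t u → a ∈ [ t ⋯ u ] → M S a ≡ M [ t ⋯ u ] a
  M-local {S} {t} {u} {a} b a∈ =
    trans (sym (ls≡M′ (elements S) a (park-elements S)))
    (trans (local (elements S) a t u (subst (λ S → IsBlock S t u) (sym (park-elements S)) b) a∈)
           (ls≡M′ _ a (park-elements-restrictedTo S [ t ⋯ u ] (IsBlock.included b))))

  private
    interval-block-unique : ∀ l m {t u a} → IsBlock [ l ⋯ m ] t u → a ∈ [ t ⋯ u ] → t ≡ l × u ≡ m
    interval-block-unique l m b a∈ with a∈′ ← IsBlock.included b a∈ with l≤a , a≤m ← ∈-interval⁻ l m a∈′ =
      runs-meet (block⇒run b) (interval-run (ℤ.≤-trans l≤a a≤m)) a∈ a∈′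

    subst-block : ∀ {S T t u} → S ≡ T → IsBlock T t u → IsBlock S t u
    subst-block refl b = b

    interval-block : ∀ {l m a} → a ∈ [ l ⋯ m ] → IsBlock [ l ⋯ m ] l m
    interval-block {l} {m} a∈ = run⇒block (interval-run (ℤ.≤-trans (proj₁ (∈-interval⁻ l m a∈)) (proj₂ (∈-interval⁻ l m a∈))))

  -- A nonempty interval is its own only block, and its enumeration is a word that fills it. The
  -- quantification over words in `DirSet` therefore collapses to one value of `M`.
  DirSet-right : ∀ l m {a} → a ∈ [ l ⋯ m ] → DirSet 𝒫 [ l ⋯ m ] a right ⇔ M [ l ⋯ m ] a ≡ ℤ.suc m
  DirSet-right l m {a} a∈ = mk⇔ forward λ eq →
    (elements [ l ⋯ m ] , park-elements [ l ⋯ m ]) ,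
    λ W W≡ → l , m , subst-block W≡ (interval-block a∈) , a∈ , trans (ls≡M′ W a W≡) eq
    where
    forward : DirSet 𝒫 [ l ⋯ m ] a right → M [ l ⋯ m ] a ≡ ℤ.suc m
    forward ((W , W≡) , dir) with t , u , b , a∈′ , eq ← dir W W≡
      with refl , refl ← interval-block-unique l m (subst-block (sym W≡) b) a∈′ = trans (sym (ls≡M′ W a W≡)) eq

  DirSet-left : ∀ l m {a} → a ∈ [ l ⋯ m ] → DirSet 𝒫 [ l ⋯ m ] a left ⇔ M [ l ⋯ m ] a ≡ ℤ.pred l
  DirSet-left l m {a} a∈ = mk⇔ forward λ eq →
    (elements [ l ⋯ m ] , park-elements [ l ⋯ m ]) ,
    λ W W≡ → l , m , subst-block W≡ (interval-block a∈) , a∈ , trans (ls≡M′ W a W≡) eq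
    where
    forward : DirSet 𝒫 [ l ⋯ m ] a left → M [ l ⋯ m ] a ≡ ℤ.pred l
    forward ((W , W≡) , dir) with t , u , b , a∈′ , eq ← dir W W≡
      with refl , refl ← interval-block-unique l m (subst-block (sym W≡) b) a∈′ = trans (sym (ls≡M′ W a W≡)) eq

  module _ {X l i r} (gap : MaximalGap X l i r) where
    open MaximalGap gap

    private
      suc-pred∉ : ¬ ℤ.suc (ℤ.pred i) ∈ X
      suc-pred∉ = gap∉ ∘ subst (_∈ X) (ℤ.suc-pred i)

      pred-suc∉ : ¬ ℤ.pred (ℤ.suc i) ∈ X
      pred-suc∉ = gap∉ ∘ subst (_∈ X) (ℤ.pred-suc i)

      nonempty : ∀ t u {a} → a ∈ [ t ⋯ u ] → t ℤ.≤ u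
      nonempty t u a∈ = ℤ.≤-trans (proj₁ (∈-interval⁻ t u a∈)) (proj₂ (∈-interval⁻ t u a∈))

      below-run : ∀ {a} → a ∈ [ l ⋯ ℤ.pred i ] → MaximalRun X l (ℤ.pred i)
      below-run a∈ = mkRun (nonempty l (ℤ.pred i) a∈) below pred∉ suc-pred∉

      above-run : ∀ {a} → a ∈ [ ℤ.suc i ⋯ r ] → MaximalRun X (ℤ.suc i) r
      above-run a∈ = mkRun (nonempty (ℤ.suc i) r a∈) above pred-suc∉ suc∉

    -- In the first case `[ l ⋯ pred i ]` is a whole block of `X`, so by `M-local` the direction
    -- within it decides, and a car sent right lands on `i`. The third case is the mirror image; in
    -- the second the preferred spot is free.
    allowed⇒M : ∀ {a} → Allowed 𝒫 l i r a → M X a ≡ i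
    allowed⇒M (inj₁ (a∈ , dir)) =
      trans (M-local (run⇒block (below-run a∈)) a∈) (trans (to (DirSet-right l (ℤ.pred i) a∈) dir) (ℤ.suc-pred i))
    allowed⇒M (inj₂ (inj₁ refl)) = M-free X gap∉
    allowed⇒M (inj₂ (inj₂ (a∈ , dir))) =
      trans (M-local (run⇒block (above-run a∈)) a∈) (trans (to (DirSet-left (ℤ.suc i) r a∈) dir) (ℤ.pred-suc i))

    module _ {a t u : ℤ} (eq : M X a ≡ i) (run : MaximalRun X t u) (a∈ : a ∈ [ t ⋯ u ]) where

      private
        t≤a : t ℤ.≤ a
        t≤a = proj₁ (∈-interval⁻ t u a∈)

        a≤u : a ℤ.≤ u
        a≤u = proj₂ (∈-interval⁻ t u a∈)

      -- The block of `a` starts at `suc i` and cannot reach `suc r`, which is not in `X`. Hence `a`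
      -- lies in `[ suc i ⋯ r ]`, itself a block of `X`, and `M-local` applies.
      parked-left : i ≡ ℤ.pred t → Allowed 𝒫 l i r a
      parked-left i≡ = inj₂ (inj₂ (a∈′ , from (DirSet-left (ℤ.suc i) r a∈′)
        (trans (sym (M-local (run⇒block (above-run a∈′)) a∈′)) (trans eq (sym (ℤ.pred-suc i))))))
        where
        t≡ : t ≡ ℤ.suc i
        t≡ = trans (sym (ℤ.suc-pred t)) (cong ℤ.suc (sym i≡))
        u≤r : u ℤ.≤ r
        u≤r = ℤ.≮⇒≥ λ r<u → suc∉ (MaximalRun.included run (∈-interval⁺ t u
          (subst (λ t → t ℤ.≤ ℤ.suc r) (sym t≡) (ℤ.suc-mono i≤r)) (ℤ.i<j⇒suc[i]≤j r<u)))
        a∈′ : a ∈ [ ℤ.suc i ⋯ r ]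
        a∈′ = ∈-interval⁺ (ℤ.suc i) r (subst (λ t → t ℤ.≤ a) t≡ t≤a) (ℤ.≤-trans a≤u u≤r)

      parked-right : i ≡ ℤ.suc u → Allowed 𝒫 l i r a
      parked-right i≡ = inj₁ (a∈′ , from (DirSet-right l (ℤ.pred i) a∈′)
        (trans (sym (M-local (run⇒block (below-run a∈′)) a∈′)) (trans eq (sym (ℤ.suc-pred i)))))
        where
        u≡ : u ≡ ℤ.pred i
        u≡ = trans (sym (ℤ.pred-suc u)) (cong ℤ.pred (sym i≡))
        l≤t : l ℤ.≤ t
        l≤t = ℤ.≮⇒≥ λ t<l → pred∉ (MaximalRun.included run (∈-interval⁺ t u (ℤ.i<j⇒i≤pred[j] t<l)
          (subst (λ u → ℤ.pred l ℤ.≤ u) (sym u≡) (ℤ.pred-mono l≤i))))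
        a∈′ : a ∈ [ l ⋯ ℤ.pred i ]
        a∈′ = ∈-interval⁺ l (ℤ.pred i) (ℤ.≤-trans l≤t t≤a) (subst (λ u → a ℤ.≤ u) u≡ a≤u)

    -- A car whose preferred spot is free takes it, which forces `a ≡ i`. Otherwise bilaterality
    -- places `i` directly before or directly after the block of `a`.
    M⇒allowed : ∀ {a} → M X a ≡ i → Allowed 𝒫 l i r a
    M⇒allowed {a} eq with a ∈? X
    ... | no  a∉X = inj₂ (inj₁ (trans (sym (M-free X a∉X)) eq))
    ... | yes a∈X = let t , u , run , a∈ = run-exists X a a∈X in
      [ (λ M≡ → parked-left  eq run a∈ (trans (sym eq) M≡))
      , (λ M≡ → parked-right eq run a∈ (trans (sym eq) M≡))
      ]′ (M-bilateral (run⇒block run) a∈)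

-- Intervals of the nodes of a canonical labeling

infix-++ : ∀ (T : Tree ℤ ⊤) xs → Infix.toDiffList T xs ≡ Infix.toList T ++ xs
infix-++ (leaf _)     xs = refl
infix-++ (node L i R) xs = begin
  Infix.toDiffList L (i ∷ Infix.toDiffList R xs)         ≡⟨ infix-++ L _ ⟩
  Infix.toList L ++ i ∷ Infix.toDiffList R xs                 ≡⟨ cong (λ ys → Infix.toList L ++ i ∷ ys) (infix-++ R xs) ⟩
  Infix.toList L ++ (i ∷ Infix.toList R) ++ xs                     ≡⟨ ++-assoc (Infix.toList L) _ xs ⟨
  (Infix.toList L ++ i ∷ Infix.toList R) ++ xs                     ≡⟨ cong (_++ xs) (infix-++ L _) ⟨
  Infix.toList (node L i R) ++ xs                             ∎
  where open ≡-Reasoning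

infix-node : ∀ (L : Tree ℤ ⊤) i R → Infix.toList (node L i R) ≡ Infix.toList L ++ i ∷ Infix.toList R
infix-node L i R = infix-++ L (i ∷ Infix.toList R)

∈-node⁻ : ∀ {k} L i R → k ∈ₗ Infix.toList (node L i R) → (k ∈ₗ Infix.toList L ⊎ k ∈ₗ Infix.toList R) ⊎ k ≡ i
∈-node⁻ L i R k∈ with ∈-++⁻ (Infix.toList L) (subst (_ ∈ₗ_) (infix-node L i R) k∈)
... | inj₁ k∈L         = inj₁ (inj₁ k∈L)
... | inj₂ (here k≡i)  = inj₂ k≡i
... | inj₂ (there k∈R) = inj₁ (inj₂ k∈R)

∈-node⁺ : ∀ {k} L i R → (k ∈ₗ Infix.toList L ⊎ k ∈ₗ Infix.toList R) ⊎ k ≡ i → k ∈ₗ Infix.toList (node L i R)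
∈-node⁺ L i R p = subst (_ ∈ₗ_) (sym (infix-node L i R)) (go p)
  where
  go : ∀ {k} → (k ∈ₗ Infix.toList L ⊎ k ∈ₗ Infix.toList R) ⊎ k ≡ i → k ∈ₗ Infix.toList L ++ i ∷ Infix.toList R
  go (inj₁ (inj₁ k∈L)) = ∈-++⁺ˡ k∈L
  go (inj₁ (inj₂ k∈R)) = ∈-++⁺ʳ (Infix.toList L) (there k∈R)
  go (inj₂ refl)       = ∈-++⁺ʳ (Infix.toList L) (here refl)

⊑-∈ : ∀ {s T k} → s ⊑ T → k ∈ₗ Infix.toList s → k ∈ₗ Infix.toList T
⊑-∈ root                    k∈ = k∈
⊑-∈ (leftᵗ  {L} {i} {R} s⊑) k∈ = ∈-node⁺ L i R (inj₁ (inj₁ (⊑-∈ s⊑ k∈)))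
⊑-∈ (rightᵗ {L} {i} {R} s⊑) k∈ = ∈-node⁺ L i R (inj₁ (inj₂ (⊑-∈ s⊑ k∈)))

node⊑-∈ : ∀ {L i R T k} → node L i R ⊑ T → (k ∈ₗ Infix.toList L ⊎ k ∈ₗ Infix.toList R) ⊎ k ≡ i → k ∈ₗ Infix.toList T
node⊑-∈ {L} {i} {R} n⊑ k∈ = ⊑-∈ n⊑ (∈-node⁺ L i R k∈)

∈⇒⊑ : ∀ {k} T → k ∈ₗ Infix.toList T → ∃₂ λ L R → node L k R ⊑ T
∈⇒⊑ (node L i R) k∈ with ∈-node⁻ L i R k∈
... | inj₁ (inj₁ k∈L) = let L′ , R′ , s⊑ = ∈⇒⊑ L k∈L in L′ , R′ , leftᵗ s⊑
... | inj₁ (inj₂ k∈R) = let L′ , R′ , s⊑ = ∈⇒⊑ R k∈R in L′ , R′ , rightᵗ s⊑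
... | inj₂ refl       = L , R , root

applyUpTo-+ : ∀ {A : Set} (f : ℕ → A) m n → applyUpTo f (m ℕ.+ n) ≡ applyUpTo f m ++ applyUpTo (λ k → f (m ℕ.+ k)) n
applyUpTo-+ f zero    n = refl
applyUpTo-+ f (suc m) n = cong (f 0 ∷_) (applyUpTo-+ (λ k → f (suc k)) m n)

applyUpTo-cong : ∀ {A : Set} {f g : ℕ → A} → (∀ k → f k ≡ g k) → ∀ n → applyUpTo f n ≡ applyUpTo g n
applyUpTo-cong f≗g zero    = refl
applyUpTo-cong f≗g (suc n) = cong₂ _∷_ (f≗g 0) (applyUpTo-cong (f≗g ∘ suc) n)

-- The root sits at offset `#nodes L`, and the labels of `R` resume one further, so the three pieces
-- join into one run of consecutive integers.
infix-inOrder : ∀ t T → Infix.toList (inOrder t T) ≡ applyUpTo (λ n → t ℤ.+ + n) (#nodes T)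
infix-inOrder t (leaf _)     = refl
infix-inOrder t (node L _ R) = begin
  Infix.toList (inOrder t (node L _ R))                                    ≡⟨ infix-node (inOrder t L) i (inOrder (ℤ.suc i) R) ⟩
  Infix.toList (inOrder t L) ++ i ∷ Infix.toList (inOrder (ℤ.suc i) R)     ≡⟨ cong₂ (λ xs ys → xs ++ i ∷ ys) (infix-inOrder t L) (infix-inOrder (ℤ.suc i) R) ⟩
  applyUpTo f #L ++ i ∷ applyUpTo (λ n → ℤ.suc i ℤ.+ + n) #R               ≡⟨ cong (λ ys → applyUpTo f #L ++ ys)
                                                                                (cong₂ _∷_ (cong f (ℕ.+-identityʳ #L)) (applyUpTo-cong shift #R)) ⟨
  applyUpTo f #L ++ applyUpTo (λ n → f (#L ℕ.+ n)) (suc #R)                ≡⟨ applyUpTo-+ f #L (suc #R) ⟨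
  applyUpTo f (#L ℕ.+ suc #R)                                              ∎
  where
  open ≡-Reasoning
  #L #R : ℕ
  #L = #nodes L
  #R = #nodes R
  f : ℕ → ℤ
  f n = t ℤ.+ + n
  i : ℤ
  i = t ℤ.+ + #L
  assoc : ∀ t m n → t ℤ.+ (m ℤ.+ (+ 1 ℤ.+ n)) ≡ + 1 ℤ.+ (t ℤ.+ m) ℤ.+ n
  assoc = solve-∀
  shift : ∀ n → f (#L ℕ.+ suc n) ≡ ℤ.suc i ℤ.+ + n
  shift n = assoc t (+ #L) (+ n)

interval-applyUpTo : ∀ t n → elements [ t ⋯ ℤ.pred (t ℤ.+ + n) ] ≡ applyUpTo (λ n → t ℤ.+ + n) n
interval-applyUpTo t n = cong (applyUpTo (λ n → t ℤ.+ + n))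
  (trans (cong (λ k → ℤ.∣ k ℤ.⊔ + 0 ∣) (width t (+ n))) (ℕ.⊔-identityʳ n))
  where
  width : ∀ t k → + 1 ℤ.+ (ℤ.- + 1 ℤ.+ (t ℤ.+ k)) ℤ.- t ≡ k
  width = solve-∀

inOrder-interval : ∀ t T → HasInterval (inOrder t T) t (ℤ.pred (t ℤ.+ + #nodes T))
inOrder-interval t T k = mk⇔ (subst (k ∈ₗ_) eq) (subst (k ∈ₗ_) (sym eq))
  where
  eq : Infix.toList (inOrder t T) ≡ elements [ t ⋯ ℤ.pred (t ℤ.+ + #nodes T) ]
  eq = trans (infix-inOrder t T) (sym (interval-applyUpTo t (#nodes T)))

-- The member `k` excludes empty intervals, whose ends are not determined. Each end then belongs to
-- the other interval.
intervals-unique : ∀ l r l′ r′ {k} → k ∈ [ l ⋯ r ] → (∀ x → x ∈ [ l ⋯ r ] ⇔ x ∈ [ l′ ⋯ r′ ]) → l ≡ l′ × r ≡ r′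
intervals-unique l r l′ r′ {k} k∈ eq =
  ℤ.≤-antisym (proj₁ (∈-interval⁻ l r (from (eq l′) (∈-interval⁺ l′ r′ ℤ.≤-refl l′≤r′))))
              (proj₁ (∈-interval⁻ l′ r′ (to (eq l) (∈-interval⁺ l r ℤ.≤-refl l≤r)))) ,
  ℤ.≤-antisym (proj₂ (∈-interval⁻ l′ r′ (to (eq r) (∈-interval⁺ l r l≤r ℤ.≤-refl))))
              (proj₂ (∈-interval⁻ l r (from (eq r′) (∈-interval⁺ l′ r′ l′≤r′ ℤ.≤-refl))))
  where
  l≤r : l ℤ.≤ r
  l≤r = ℤ.≤-trans (proj₁ (∈-interval⁻ l r k∈)) (proj₂ (∈-interval⁻ l r k∈))
  l′≤r′ : l′ ℤ.≤ r′
  l′≤r′ = ℤ.≤-trans (proj₁ (∈-interval⁻ l′ r′ (to (eq k) k∈))) (proj₂ (∈-interval⁻ l′ r′ (to (eq k) k∈)))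

hasInterval-unique : ∀ s l r l′ r′ {k} → k ∈ₗ Infix.toList s → HasInterval s l r → HasInterval s l′ r′ → l ≡ l′ × r ≡ r′
hasInterval-unique s l r l′ r′ k∈ I I′ = intervals-unique l r l′ r′ (to (I _) k∈)
  λ x → mk⇔ (to (I′ x) ∘ from (I x)) (to (I x) ∘ from (I′ x))

-- The neighbours of the interval of a subtree s of inOrder t T are ancestors of
-- s, unless they lie outside the whole tree.
record Position (t : ℤ) (T : BinaryTree) (s : Tree ℤ ⊤) : Set where
  constructor position
  field
    {offset} : ℤ
    {shape′} : BinaryTree
    subtree  : s ≡ inOrder offset shape′
    start    : offset ≡ t ⊎ ∃₂ λ L R → node L (ℤ.pred offset) R ⊑ inOrder t T × s ⊑ R
    finish   : offset ℤ.+ + #nodes shape′ ≡ t ℤ.+ + #nodes T ⊎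
               ∃₂ λ L R → node L (offset ℤ.+ + #nodes shape′) R ⊑ inOrder t T × s ⊑ L

-- A step to the left keeps the lower neighbour; if `s` reaches the end of the left subtree, the
-- node just left behind becomes its upper neighbour. A step to the right exchanges the two roles.
locate : ∀ {s} t T → s ⊑ inOrder t T → Position t T s
locate t T@(leaf _)     root = position {shape′ = T} refl (inj₁ refl) (inj₁ refl)
locate t T@(node _ _ _) root = position {shape′ = T} refl (inj₁ refl) (inj₁ refl)
locate t T@(node L _ R) (leftᵗ s⊑) with locate t L s⊑
... | position {o} {T′} refl start finish = position {shape′ = T′} refl
  ([ inj₁ , (λ (A , B , a⊑ , s⊑B) → inj₂ (A , B , leftᵗ a⊑ , s⊑B)) ]′ start)
  ([ (λ eq → inj₂ (inOrder t L , inOrder (ℤ.suc (t ℤ.+ + #nodes L)) R , subst (λ k → node (inOrder t L) k (inOrder (ℤ.suc (t ℤ.+ + #nodes L)) R) ⊑ inOrder t T) (sym eq) root , s⊑))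
   , (λ (A , B , a⊑ , s⊑A) → inj₂ (A , B , leftᵗ a⊑ , s⊑A)) ]′ finish)
locate t T@(node L _ R) (rightᵗ s⊑) with locate (ℤ.suc (t ℤ.+ + #nodes L)) R s⊑
... | position {o} {T′} refl start finish = position {shape′ = T′} refl
  ([ (λ { refl → inj₂ (inOrder t L , inOrder (ℤ.suc (t ℤ.+ + #nodes L)) R , subst (λ k → node (inOrder t L) k (inOrder (ℤ.suc (t ℤ.+ + #nodes L)) R) ⊑ inOrder t T) (sym (ℤ.pred-suc (t ℤ.+ + #nodes L))) root , s⊑) })
   , (λ (A , B , a⊑ , s⊑B) → inj₂ (A , B , rightᵗ a⊑ , s⊑B)) ]′ start)
  ([ (λ eq → inj₁ (trans eq (assoc t (+ #nodes L) (+ #nodes R))))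
   , (λ (A , B , a⊑ , s⊑A) → inj₂ (A , B , rightᵗ a⊑ , s⊑A)) ]′ finish)
  where
  assoc : ∀ t m n → + 1 ℤ.+ (t ℤ.+ m) ℤ.+ n ≡ t ℤ.+ (m ℤ.+ (+ 1 ℤ.+ n))
  assoc = solve-∀

module _ (F : IndexedForest) {t u : ℤ} (b : IsBlock (support F) t u) where

  infix-canonical : Infix.toList (canonical F t u b) ≡ elements [ t ⋯ u ]
  infix-canonical = trans (infix-inOrder t (tree F t u b))
    (cong (applyUpTo (λ n → t ℤ.+ + n)) (trans (tree-size F t u b) (length-applyUpTo _ _)))

  -- Reconciles the end of the tree as `locate` measures it, by counting nodes, with the end `u` of
  -- the block.
  canonical-end : t ℤ.+ + #nodes (tree F t u b) ≡ ℤ.suc u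
  canonical-end = trans (sym (ℤ.suc-pred _)) (cong ℤ.suc (sym (proj₂ (intervals-unique t u t (ℤ.pred (t ℤ.+ + #nodes T))
    (∈-interval⁺ t u ℤ.≤-refl (IsBlock.nonempty b)) λ x → mk⇔
      (to (inOrder-interval t T x) ∘ subst (x ∈ₗ_) (sym infix-canonical))
      (subst (x ∈ₗ_) infix-canonical ∘ from (inOrder-interval t T x))))))
    where
    T : BinaryTree
    T = tree F t u b

  canonical⊆support : ∀ {s k} → s ⊑ canonical F t u b → k ∈ₗ Infix.toList s → k ∈ support F
  canonical⊆support s⊑ k∈ = IsBlock.included b (subst (_ ∈ₗ_) infix-canonical (⊑-∈ s⊑ k∈))

-- Gaps in decreasing forests

module _ {A : Set} (P : LabeledForest A) (default : A) where

  -- A total version of `label`, so that labels can be compared and moved along equations without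
  -- membership proofs.
  labelAt : ℤ → A
  labelAt i with i ∈? support (shape P)
  ... | yes h = label P i h
  ... | no  _ = default

  labelAt-≡ : ∀ {i} .(h : i ∈ support (shape P)) → labelAt i ≡ label P i h
  labelAt-≡ {i} h with i ∈? support (shape P)
  ... | yes _ = refl
  ... | no ∉S = contradiction (recompute (i ∈? support (shape P)) h) ∉S

module _ (Q : LabeledForest ℕ) (decr : IsDecreasing Q) where
  private
    S : Finℤ
    S = support (shape Q)
    q : ℤ → ℕ
    q = labelAt Q 0

  open IsDecreasing decr

  q-decreasing : ∀ {t u} (b : IsBlock S t u) {L i R} → node L i R ⊑ canonical (shape Q) t u b →
                 ∀ {j} → j ∈ₗ Infix.toList L ⊎ j ∈ₗ Infix.toList R → q j ℕ.< q i
  q-decreasing b {L} {i} {R} n⊑ {j} j∈ = ℕ.≤-trans (ℕ.≤-reflexive (cong suc (labelAt-≡ Q 0 hj)))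
    (ℕ.≤-trans (decreasing _ _ b n⊑ j j∈ hi hj) (ℕ.≤-reflexive (sym (labelAt-≡ Q 0 hi))))
    where
    hi : i ∈ S
    hi = canonical⊆support (shape Q) b n⊑ (∈-node⁺ L i R (inj₂ refl))
    hj : j ∈ S
    hj = canonical⊆support (shape Q) b n⊑ (∈-node⁺ L i R (inj₁ j∈))

  module _ {t u} (b : IsBlock S t u) {L i R} (n⊑ : node L i R ⊑ canonical (shape Q) t u b)
           l r (I : HasInterval (node L i R) l r)
           {X} (X≡ : ∀ x → x ∈ X ⇔ (x ∈ S × q x ℕ.< q i)) where

    private
      i∈ : i ∈ₗ Infix.toList (node L i R)
      i∈ = ∈-node⁺ L i R (inj₂ refl)

      open Position (locate t (tree (shape Q) t u b) n⊑)

      bounds : l ≡ offset × r ≡ ℤ.pred (offset ℤ.+ + #nodes shape′)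
      bounds = hasInterval-unique (node L i R) l r offset (ℤ.pred (offset ℤ.+ + #nodes shape′)) i∈ I
        (subst (λ s → HasInterval s offset (ℤ.pred (offset ℤ.+ + #nodes shape′))) (sym subtree) (inOrder-interval offset shape′))

      -- An ancestor has a larger label than `i`, so its car arrives later.
      ancestor∉X : ∀ {A k B} → node A k B ⊑ canonical (shape Q) t u b →
                   i ∈ₗ Infix.toList A ⊎ i ∈ₗ Infix.toList B → ¬ k ∈ X
      ancestor∉X a⊑ i∈AB k∈X = ℕ.<-asym (q-decreasing b a⊑ i∈AB) (proj₂ (to (X≡ _) k∈X))

      l≤node : l ℤ.≤ i
      l≤node = proj₁ (∈-interval⁻ l r (to (I i) i∈))

      node≤r : i ℤ.≤ r
      node≤r = proj₂ (∈-interval⁻ l r (to (I i) i∈))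

      node∉X : ¬ i ∈ X
      node∉X i∈X = ℕ.<-irrefl refl (proj₂ (to (X≡ i) i∈X))

      descendant∈X : ∀ {x} → l ℤ.≤ x → x ℤ.≤ r → x ≢ i → x ∈ X
      descendant∈X {x} l≤x x≤r x≢i with x∈ ← from (I x) (∈-interval⁺ l r l≤x x≤r) with ∈-node⁻ L i R x∈
      ... | inj₁ x∈LR = from (X≡ x) (canonical⊆support (shape Q) b n⊑ x∈ , q-decreasing b n⊑ x∈LR)
      ... | inj₂ x≡i  = contradiction x≡i x≢i

      below⊆X : [ l ⋯ ℤ.pred i ] ⊆ X
      below⊆X x∈ with l≤x , x≤ ← ∈-interval⁻ l (ℤ.pred i) x∈ with x<i ← ℤ.i≤pred[j]⇒i<j x≤ =
        descendant∈X l≤x (ℤ.≤-trans (ℤ.<⇒≤ x<i) node≤r) (ℤ.<⇒≢ x<i)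

      above⊆X : [ ℤ.suc i ⋯ r ] ⊆ X
      above⊆X x∈ with ≤x , x≤r ← ∈-interval⁻ (ℤ.suc i) r x∈ with i<x ← ℤ.suc[i]≤j⇒i<j ≤x =
        descendant∈X (ℤ.≤-trans l≤node (ℤ.<⇒≤ i<x)) x≤r (ℤ.<⇒≢ i<x ∘ sym)

      pred∉X : ¬ ℤ.pred l ∈ X
      pred∉X = subst (λ l → ¬ ℤ.pred l ∈ X) (sym (proj₁ bounds))
        ([ (λ eq → subst (λ l → ¬ ℤ.pred l ∈ X) (sym eq) (MaximalRun.pred∉ (block⇒run b) ∘ proj₁ ∘ to (X≡ _)))
         , (λ (A , B , a⊑ , n⊑B) → ancestor∉X a⊑ (inj₂ (⊑-∈ n⊑B i∈))) ]′ start)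

      suc∉X : ¬ ℤ.suc r ∈ X
      suc∉X = subst (λ k → ¬ k ∈ X) (sym (trans (cong ℤ.suc (proj₂ bounds)) (ℤ.suc-pred _)))
        ([ (λ eq → subst (λ k → ¬ k ∈ X) (sym (trans eq (canonical-end (shape Q) b)))
                     (MaximalRun.suc∉ (block⇒run b) ∘ proj₁ ∘ to (X≡ _)))
         , (λ (A , B , a⊑ , n⊑A) → ancestor∉X a⊑ (inj₁ (⊑-∈ n⊑A i∈))) ]′ finish)

    -- The set `X` is fixed only through its members, so that it can be the parked set of a prefix
    -- of a given word as well as of a word still under construction.
    maximalGap : MaximalGap X l i r
    maximalGap = record
      { l≤i   = l≤node
      ; i≤r   = node≤r
      ; gap∉  = node∉X
      ; below = below⊆X
      ; above = above⊆X
      ; pred∉ = pred∉X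
      ; suc∉  = suc∉X
      }

-- Decreasing labelings

-- If `y` were missed, punching it out of the codomain would inject `Fin (suc n)` into `Fin n`.
injective⇒surjective : ∀ {n} {f : Fin n → Fin n} → (∀ {i j} → f i ≡ f j → i ≡ j) → ∀ y → ∃ λ x → f x ≡ y
injective⇒surjective {suc n} {f} f-inj y with Fin.any? (λ x → f x Fin.≟ y)
... | yes hit = hit
... | no ¬hit = contradiction (Fin.injective⇒≤ (f-inj ∘ Fin.punchOut-injective (y≢ _) (y≢ _))) ℕ.1+n≰n
  where
  y≢ : ∀ x → y ≢ f x
  y≢ x y≡ = ¬hit (x , sym y≡)

module _ {A : Set} {P Q : A → Set} (P? : Decidable P) (Q? : Decidable Q) (P⇒Q : ∀ {x} → P x → Q x) where

  length-filter-≤ : ∀ xs → length (filter P? xs) ℕ.≤ length (filter Q? xs)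
  length-filter-≤ [] = z≤n
  length-filter-≤ (x ∷ xs) with P? x | Q? x
  ... | yes _ | yes _ = s≤s (length-filter-≤ xs)
  ... | yes p | no ¬q = contradiction (P⇒Q p) ¬q
  ... | no  _ | yes _ = ℕ.m≤n⇒m≤1+n (length-filter-≤ xs)
  ... | no  _ | no  _ = length-filter-≤ xs

  length-filter-< : ∀ {x xs} → x ∈ₗ xs → ¬ P x → Q x → length (filter P? xs) ℕ.< length (filter Q? xs)
  length-filter-< {xs = y ∷ xs} (here refl) ¬p q with P? y | Q? y
  ... | yes p | _     = contradiction p ¬p
  ... | no  _ | no ¬q = contradiction q ¬q
  ... | no  _ | yes _ = s≤s (length-filter-≤ xs)
  length-filter-< {xs = y ∷ xs} (there x∈) ¬p q with P? y | Q? y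
  ... | yes _ | yes _ = s≤s (length-filter-< x∈ ¬p q)
  ... | yes p | no ¬q = contradiction (P⇒Q p) ¬q
  ... | no  _ | yes _ = ℕ.m≤n⇒m≤1+n (length-filter-< x∈ ¬p q)
  ... | no  _ | no  _ = length-filter-< x∈ ¬p q

-- Ranking a finite set by a key

module Rank (S : Finℤ) (key : ℤ → ℕ) where

  private
    module Lex = StrictTotalOrder (×-strictTotalOrder ℕ.<-strictTotalOrder ℤ.<-strictTotalOrder)

    -- Ties between equal keys are broken by the integers themselves. The order becomes total, hence
    -- ranks are distinct, and strict inequalities of keys survive.
    _≺_ : ℤ → ℤ → Set
    i ≺ j = (key i , i) Lex.< (key j , j)

    _≺?_ : ∀ i j → Dec (i ≺ j)
    i ≺? j = (key i , i) Lex.<? (key j , j)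

    ≺-irrefl : ∀ {i} → ¬ i ≺ i
    ≺-irrefl = Lex.irrefl Lex.Eq.refl

  rank : ℤ → ℕ
  rank i = length (filter (_≺? i) (elements S))

  private
    rank-≺ : ∀ {i j} → i ∈ S → i ≺ j → rank i ℕ.< rank j
    rank-≺ {i} {j} i∈ i≺j = length-filter-< (_≺? i) (_≺? j) (λ k≺i → Lex.trans k≺i i≺j) i∈ ≺-irrefl i≺j

  rank-mono : ∀ {i j} → i ∈ S → key i ℕ.< key j → rank i ℕ.< rank j
  rank-mono i∈ k<k = rank-≺ i∈ (inj₁ k<k)

  rank-injective : ∀ {i j} → i ∈ S → j ∈ S → rank i ≡ rank j → i ≡ j
  rank-injective {i} {j} i∈ j∈ eq with Lex.compare (key i , i) (key j , j)
  ... | tri< i≺j _ _ = contradiction eq (ℕ.<⇒≢ (rank-≺ i∈ i≺j))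
  ... | tri≈ _ (_ , i≡j) _ = i≡j
  ... | tri> _ _ j≺i = contradiction (sym eq) (ℕ.<⇒≢ (rank-≺ j∈ j≺i))

  rank-< : ∀ {i} → i ∈ S → rank i ℕ.< ∣ S ∣
  rank-< {i} i∈ = filter-notAll (_≺? i) (elements S) (Any.map (λ { refl → ≺-irrefl }) i∈)

  private
    rankFin : Fin ∣ S ∣ → Fin ∣ S ∣
    rankFin k = Fin.fromℕ< (rank-< (∈-lookup {xs = elements S} k))

    rankFin-injective : ∀ {j k} → rankFin j ≡ rankFin k → j ≡ k
    rankFin-injective {j} {k} eq = lookup-injective (elements-unique S) (rank-injective (∈-lookup j) (∈-lookup k)
      (Fin.fromℕ<-injective _ _ (rank-< (∈-lookup j)) (rank-< (∈-lookup k)) eq))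

  -- Ranks are distinct and below `∣ S ∣`, so as a self-map of `Fin ∣ S ∣` the ranking hits every
  -- value.
  rank-surjective : ∀ {n} → n ℕ.< ∣ S ∣ → ∃ λ i → i ∈ S × rank i ≡ n
  rank-surjective n< with k , eq ← injective⇒surjective rankFin-injective (Fin.fromℕ< n<) =
    lookup (elements S) k , ∈-lookup k ,
    trans (sym (Fin.toℕ-fromℕ< (rank-< (∈-lookup k)))) (trans (cong toℕ eq) (Fin.toℕ-fromℕ< n<))

-- The size of the subtree rooted at k, when T is a search tree containing k.
subtreeSize : Tree ℤ ⊤ → ℤ → ℕ
subtreeSize (leaf _)     k = 0
subtreeSize (node L i R) k with ℤ.<-cmp k i
... | tri< _ _ _ = subtreeSize L k
... | tri≈ _ _ _ = #nodes (node L i R)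
... | tri> _ _ _ = subtreeSize R k

subtreeSize-≤ : ∀ T k → subtreeSize T k ℕ.≤ #nodes T
subtreeSize-≤ (leaf _)     k = z≤n
subtreeSize-≤ (node L i R) k with ℤ.<-cmp k i
... | tri< _ _ _ = ℕ.≤-trans (subtreeSize-≤ L k) (ℕ.m≤m+n _ _)
... | tri≈ _ _ _ = ℕ.≤-refl
... | tri> _ _ _ = ℕ.≤-trans (subtreeSize-≤ R k) (ℕ.≤-trans (ℕ.n≤1+n _) (ℕ.m≤n+m _ (#nodes L)))

subtreeSize-left : ∀ L {i} R {k} → k ℤ.< i → subtreeSize (node L i R) k ≡ subtreeSize L k
subtreeSize-left L {i} R {k} k<i with ℤ.<-cmp k i
... | tri< _ _ _   = refl
... | tri≈ k≮i _ _ = contradiction k<i k≮i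
... | tri> k≮i _ _ = contradiction k<i k≮i

subtreeSize-right : ∀ L {i} R {k} → i ℤ.< k → subtreeSize (node L i R) k ≡ subtreeSize R k
subtreeSize-right L {i} R {k} i<k with ℤ.<-cmp k i
... | tri< _ _ k≯i = contradiction i<k k≯i
... | tri≈ _ _ k≯i = contradiction i<k k≯i
... | tri> _ _ _   = refl

subtreeSize-root : ∀ L i R → subtreeSize (node L i R) i ≡ #nodes (node L i R)
subtreeSize-root L i R with ℤ.<-cmp i i
... | tri< _ i≢i _ = contradiction refl i≢i
... | tri≈ _ _ _   = refl
... | tri> _ i≢i _ = contradiction refl i≢i

inOrder-left : ∀ t L {k} → k ∈ₗ Infix.toList (inOrder t L) → k ℤ.< t ℤ.+ + #nodes L
inOrder-left t L {k} k∈ = ℤ.i≤pred[j]⇒i<j (proj₂ (∈-interval⁻ t (ℤ.pred (t ℤ.+ + #nodes L)) (to (inOrder-interval t L k) k∈)))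

inOrder-right : ∀ i R {k} → k ∈ₗ Infix.toList (inOrder (ℤ.suc i) R) → i ℤ.< k
inOrder-right i R {k} k∈ =
  ℤ.suc[i]≤j⇒i<j (proj₁ (∈-interval⁻ (ℤ.suc i) (ℤ.pred (ℤ.suc i ℤ.+ + #nodes R)) (to (inOrder-interval (ℤ.suc i) R k) k∈)))

-- At the root, the value for a descendant is bounded by the size of a proper subtree. Deeper down,
-- the in-order labels send the searches for `i` and `j` into the same branch.
subtreeSize-decreasing : ∀ t T {L i R} → node L i R ⊑ inOrder t T → ∀ {j} → j ∈ₗ Infix.toList L ⊎ j ∈ₗ Infix.toList R →
                         subtreeSize (inOrder t T) j ℕ.< subtreeSize (inOrder t T) i
subtreeSize-decreasing t (node A _ B) root j∈ =
  ℕ.<-≤-trans (strict j∈) (ℕ.≤-reflexive (sym (subtreeSize-root L i R)))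
  where
  i : ℤ
  i = t ℤ.+ + #nodes A
  L R : Tree ℤ ⊤
  L = inOrder t A
  R = inOrder (ℤ.suc i) B
  strict : ∀ {j} → j ∈ₗ Infix.toList L ⊎ j ∈ₗ Infix.toList R → subtreeSize (node L i R) j ℕ.< #nodes (node L i R)
  strict {j} (inj₁ j∈L) = ℕ.≤-<-trans (ℕ.≤-reflexive (subtreeSize-left L R (inOrder-left t A j∈L)))
    (ℕ.≤-<-trans (subtreeSize-≤ L j) (ℕ.m<m+n _ (s≤s z≤n)))
  strict {j} (inj₂ j∈R) = ℕ.≤-<-trans (ℕ.≤-reflexive (subtreeSize-right L R (inOrder-right i B j∈R)))
    (ℕ.≤-<-trans (subtreeSize-≤ R j) (ℕ.<-≤-trans (ℕ.n<1+n _) (ℕ.m≤n+m _ (#nodes L))))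
subtreeSize-decreasing t (node A _ B) (leftᵗ {L} {_} {R} n⊑) {j} j∈ =
  subst₂ ℕ._<_ (sym (subtreeSize-left L R (inOrder-left t A (node⊑-∈ n⊑ (inj₁ j∈)))))
               (sym (subtreeSize-left L R (inOrder-left t A (node⊑-∈ n⊑ (inj₂ refl)))))
               (subtreeSize-decreasing t A n⊑ j∈)
subtreeSize-decreasing t (node A _ B) (rightᵗ {L} {i} {R} n⊑) {j} j∈ =
  subst₂ ℕ._<_ (sym (subtreeSize-right L R (inOrder-right i B (node⊑-∈ n⊑ (inj₁ j∈)))))
               (sym (subtreeSize-right L R (inOrder-right i B (node⊑-∈ n⊑ (inj₂ refl)))))
               (subtreeSize-decreasing (ℤ.suc i) B n⊑ j∈)

-- A decreasing labeling of any shape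

module _ (F : IndexedForest) where
  private
    S : Finℤ
    S = support F

    blockSize : ∀ {x} → ∃₂ (λ t u → MaximalRun S t u × x ∈ [ t ⋯ u ]) → ℕ
    blockSize {x} (t , u , run , _) = subtreeSize (canonical F t u (run⇒block run)) x

    key : ℤ → ℕ
    key x with x ∈? S
    ... | yes x∈S = blockSize (run-exists S x x∈S)
    ... | no  _   = 0

    -- By `runs-meet` the run chosen by `run-exists` is the given block, so the choice does not
    -- affect the key.
    blockSize-≡ : ∀ {t u x} (b : IsBlock S t u) → x ∈ [ t ⋯ u ] → ∀ r → blockSize {x} r ≡ subtreeSize (canonical F t u b) x
    blockSize-≡ b x∈ (_ , _ , run , x∈′) with refl , refl ← runs-meet run (block⇒run b) x∈′ x∈ = refl

    key-≡ : ∀ {t u x} (b : IsBlock S t u) → x ∈ [ t ⋯ u ] → key x ≡ subtreeSize (canonical F t u b) x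
    key-≡ {x = x} b x∈ with x ∈? S
    ... | yes x∈S = blockSize-≡ b x∈ (run-exists S x x∈S)
    ... | no  x∉S = contradiction (IsBlock.included b x∈) x∉S

    key-decreasing : ∀ {t u} (b : IsBlock S t u) {L i R} → node L i R ⊑ canonical F t u b →
                     ∀ {j} → j ∈ₗ Infix.toList L ⊎ j ∈ₗ Infix.toList R → key j ℕ.< key i
    key-decreasing {t} {u} b {L} {i} {R} n⊑ {j} j∈ =
      subst₂ ℕ._<_ (sym (key-≡ b (inBlock (inj₁ j∈)))) (sym (key-≡ b (inBlock (inj₂ refl))))
             (subtreeSize-decreasing t (tree F t u b) n⊑ j∈)
      where
      inBlock : ∀ {k} → (k ∈ₗ Infix.toList L ⊎ k ∈ₗ Infix.toList R) ⊎ k ≡ i → k ∈ [ t ⋯ u ]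
      inBlock k∈ = subst (_ ∈ₗ_) (infix-canonical F b) (node⊑-∈ n⊑ k∈)

    open Rank S key

  -- Subtree sizes grow strictly from a node to its ancestors, so ranking the nodes by them gives a
  -- decreasing labeling. The successor makes the labels start at 1.
  decreasingForest : LabeledForest ℕ
  decreasingForest = record { shape = F ; label = λ i _ → suc (rank i) }

  decreasingForest-decreasing : IsDecreasing decreasingForest
  decreasingForest-decreasing = record
    { range      = λ i h → s≤s z≤n , rank-< (recompute (i ∈? S) h)
    ; injective  = λ i j h k eq → rank-injective (recompute (i ∈? S) h) (recompute (j ∈? S) k) (ℕ.suc-injective eq)
    ; surjective = λ { (suc n) _ n< → let i , i∈ , eq = rank-surjective n< in i , i∈ , cong suc eq }
    ; decreasing = λ t u b n⊑ j j∈ h k → s≤s (rank-mono (recompute (j ∈? S) k)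
                     (key-decreasing (recompute (isBlock? S t u) b) n⊑ j∈))
    }

-- The correspondence

≈-trans : ∀ {F G H} → F ≈ G → G ≈ H → F ≈ H
≈-trans {F} {G} {H} (S≡ , trees) (S≡′ , trees′) = trans S≡ S≡′ , λ t u b c →
  trans (trees t u b (subst (λ S → IsBlock S t u) S≡ b)) (trees′ t u (subst (λ S → IsBlock S t u) S≡ b) c)

⊑-resp-≈ : ∀ {F G t u s} → F ≈ G → .(b : IsBlock (support F) t u) .(c : IsBlock (support G) t u) →
           s ⊑ canonical F t u b → s ⊑ canonical G t u c
⊑-resp-≈ {t = t} {u} {s} (_ , trees) b c = subst (λ T → s ⊑ inOrder t T) (trees t u b c)

take-applyUpTo : ∀ {A : Set} (f : ℕ → A) {m n} → m ℕ.≤ n → take m (applyUpTo f n) ≡ applyUpTo f m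
take-applyUpTo f z≤n       = refl
take-applyUpTo f (s≤s m≤n) = cong (f 0 ∷_) (take-applyUpTo (f ∘ suc) m≤n)

record NodeAt (F : IndexedForest) (i : ℤ) : Set where
  field
    {t u l r} : ℤ
    {L R}     : Tree ℤ ⊤
    block     : IsBlock (support F) t u
    subtree   : node L i R ⊑ canonical F t u block
    interval  : HasInterval (node L i R) l r

nodeAt : ∀ F {i} → i ∈ support F → NodeAt F i
nodeAt F {i} i∈ = go (run-exists (support F) i i∈)
  where
  go : (∃₂ λ t u → MaximalRun (support F) t u × i ∈ [ t ⋯ u ]) → NodeAt F i
  go (t , u , run , i∈′)
    with L , R , n⊑ ← ∈⇒⊑ (inOrder t (tree F t u (run⇒block run)))
                          (subst (i ∈ₗ_) (sym (infix-canonical F (run⇒block run))) i∈′)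
    with position {o} {T} n≡ _ _ ← locate t (tree F t u (run⇒block run)) n⊑ = record
      { block    = run⇒block run
      ; subtree  = n⊑
      ; l        = o
      ; r        = ℤ.pred (o ℤ.+ + #nodes T)
      ; interval = subst (λ s → HasInterval s o (ℤ.pred (o ℤ.+ + #nodes T))) (sym n≡) (inOrder-interval o T)
      }

-- Parked sets of prefixes

module Prefixes (𝒫 : ParkingProcedure) where
  open ParkingProcedure 𝒫
  open Parking 𝒫

  park-++ : ∀ V V′ → park V ⊆ park (V ++ V′)
  park-++ V []       x∈ = subst (λ V → _ ∈ park V) (sym (++-identityʳ V)) x∈
  park-++ V (a ∷ V′) x∈ = subst (λ V → _ ∈ park V) (++-assoc V (a ∷ []) V′) (park-++ (V ∷ʳ a) V′ (extends V a x∈))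

  park-take-mono : ∀ W {m n} → m ℕ.≤ n → park (take m W) ⊆ park (take n W)
  park-take-mono W {m} {n} m≤n {x} x∈ = subst (λ V → x ∈ park V)
    (trans (cong (_++ drop m (take n W)) (sym prefix)) (take++drop≡id m (take n W)))
    (park-++ (take m W) _ x∈)
    where
    prefix : take m (take n W) ≡ take m W
    prefix = trans (take-take m n W) (cong (λ k → take k W) (ℕ.m≤n⇒m⊓n≡m m≤n))

  park-take⊆park : ∀ W m → park (take m W) ⊆ park W
  park-take⊆park W m {x} x∈ = subst (λ V → x ∈ park V) (take++drop≡id m W) (park-++ (take m W) (drop m W) x∈)

  -- A spot is free until its car arrives and stays occupied afterwards.
  park-take⇔ : ∀ W {x n} → Outcome 𝒫 W x n → ∀ m → x ∈ park (take m W) ⇔ n ℕ.≤ m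
  park-take⇔ W (j , refl , refl) m = mk⇔
    (λ x∈ → ℕ.≰⇒> λ m≤j → ls-free _ _ (park-take-mono W m≤j x∈))
    (λ j<m → park-take-mono W j<m (subst (λ V → spot 𝒫 W j ∈ park V) (sym (take-suc W j)) (ls-parked _ _)))

module Correspondence (𝒫 : ParkingProcedure) (bilateral : Bilateral 𝒫)
                      (local : LocallyDecided 𝒫) (memoryless : Memoryless 𝒫) where
  open ParkingProcedure 𝒫
  open Parking 𝒫
  open Prefixes 𝒫
  open BilateralLocal 𝒫 bilateral local memoryless

  -- From a word to the label condition

  module _ {W P Q} (m : _↦_,_ 𝒫 W P Q) where
    open _↦_,_ m

    private
      S : Finℤ
      S = support (shape Q)
      q : ℤ → ℕ
      q = labelAt Q 0

      outcome : ∀ {x} → x ∈ S → Outcome 𝒫 W x (q x)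
      outcome {x} x∈ = subst (Outcome 𝒫 W x) (sym (labelAt-≡ Q 0 x∈)) (Q-label x x∈)

    -- The bound is written `suc n` because this is the label of the node taken by the next car; the
    -- right side then has the form that `maximalGap` expects.
    park-take-outcome : ∀ n x → x ∈ park (take n W) ⇔ (x ∈ S × q x ℕ.< suc n)
    park-take-outcome n x = mk⇔
      (λ x∈ → let x∈S = subst (x ∈_) (sym Q-support) (park-take⊆park W n x∈)
              in x∈S , s≤s (to (park-take⇔ W (outcome x∈S) n) x∈))
      (λ { (x∈S , s≤s q≤n) → from (park-take⇔ W (outcome x∈S) n) q≤n })

    image⇒labelCondition : LabelCondition 𝒫 P
    image⇒labelCondition t u b {L} {i} {R} n⊑ l r I h =
      M⇒allowed (maximalGap Q Q-decreasing bQ n⊑Q l r I X≡)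
                (trans (sym (ls≡M _ _)) (trans (cong (ls 𝒫 (take (toℕ j) W)) letter) spot≡))
      where
      S≡ : support (shape P) ≡ S
      S≡ = proj₁ same-shape
      bQ : IsBlock S t u
      bQ = subst (λ S → IsBlock S t u) (S≡) (recompute (isBlock? (support (shape P)) t u) b)
      n⊑Q : node L i R ⊑ canonical (shape Q) t u bQ
      n⊑Q = ⊑-resp-≈ {shape P} {shape Q} same-shape b bQ n⊑
      i∈S : i ∈ S
      i∈S = subst (i ∈_) (S≡) (recompute (i ∈? support (shape P)) h)
      j : Fin (length W)
      j = proj₁ (outcome i∈S)
      spot≡ : spot 𝒫 W j ≡ i
      spot≡ = proj₁ (proj₂ (outcome i∈S))
      q≡ : q i ≡ suc (toℕ j)
      q≡ = proj₂ (proj₂ (outcome i∈S))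
      letter : label P i h ≡ lookup W j
      -- `P-label` and `Q-label` each yield an index into `W`. Both are one less than the label of
      -- `i` in `Q`, so they coincide.
      letter with j′ , q≡′ , a≡ ← P-label i h i∈S =
        trans a≡ (cong (lookup W) (Fin.toℕ-injective (ℕ.suc-injective
          (trans (sym q≡′) (trans (sym (labelAt-≡ Q 0 i∈S)) q≡)))))
      X≡ : ∀ x → x ∈ park (take (toℕ j) W) ⇔ (x ∈ S × q x ℕ.< q i)
      X≡ x = subst (λ n → x ∈ park (take (toℕ j) W) ⇔ (x ∈ S × q x ℕ.< n)) (sym q≡) (park-take-outcome (toℕ j) x)

  -- From the label condition to a word

  module _ {P : LabeledForest ℤ} {Q : LabeledForest ℕ} (condition : LabelCondition 𝒫 P)
           (decr : IsDecreasing Q) (P≈Q : shape P ≈ shape Q) where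
    open IsDecreasing decr

    private
      S : Finℤ
      S = support (shape Q)
      q : ℤ → ℕ
      q = labelAt Q 0
      p : ℤ → ℤ
      p = labelAt P (+ 0)

    -- The inverse of the labeling, shifted by one since labels start at 1. The arbitrary value
    -- `+ 0` out of range makes it total, as `applyUpTo` requires.
    nodeOfRank : ℕ → ℤ
    nodeOfRank n with n ℕ.<? ∣ S ∣
    ... | yes n< = proj₁ (surjective (suc n) (s≤s z≤n) n<)
    ... | no  _  = + 0

    nodeOfRank-spec : ∀ {n} → n ℕ.< ∣ S ∣ → nodeOfRank n ∈ S × q (nodeOfRank n) ≡ suc n
    nodeOfRank-spec {n} n< with n ℕ.<? ∣ S ∣
    ... | yes n<′ = let i , h , eq = surjective (suc n) (s≤s z≤n) n<′ in h , trans (labelAt-≡ Q 0 h) eq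
    ... | no  n≮  = contradiction n< n≮

    q-injective : ∀ {i j} → i ∈ S → j ∈ S → q i ≡ q j → i ≡ j
    q-injective {i} {j} i∈ j∈ eq =
      injective i j i∈ j∈ (trans (sym (labelAt-≡ Q 0 i∈)) (trans eq (labelAt-≡ Q 0 j∈)))

    ≡nodeOfRank : ∀ {i n} → i ∈ S → n ℕ.< ∣ S ∣ → q i ≡ suc n → i ≡ nodeOfRank n
    ≡nodeOfRank i∈ n< eq = let h , eq′ = nodeOfRank-spec n< in q-injective i∈ h (trans eq (sym eq′))

    -- The word is forced: the `P`-labels must be read in the order of the `Q`-labels.
    letter : ℕ → ℤ
    letter n = p (nodeOfRank n)

    q-range : ∀ {i} → i ∈ S → 1 ℕ.≤ q i × q i ℕ.≤ ∣ S ∣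
    q-range {i} i∈ = subst (λ n → 1 ℕ.≤ n × n ℕ.≤ ∣ S ∣) (sym (labelAt-≡ Q 0 i∈)) (range i i∈)

    Parked : ℕ → Set
    Parked n = ∀ x → x ∈ park (applyUpTo letter n) ⇔ (x ∈ S × q x ℕ.≤ n)

    module _ {n} (n< : n ℕ.< ∣ S ∣) (parked : Parked n) where
      private
        i : ℤ
        i = nodeOfRank n

        i∈S : i ∈ S
        i∈S = proj₁ (nodeOfRank-spec n<)

        i∈P : i ∈ support (shape P)
        i∈P = subst (i ∈_) (sym (proj₁ P≈Q)) i∈S

        X≡ : ∀ x → x ∈ park (applyUpTo letter n) ⇔ (x ∈ S × q x ℕ.< q i)
        X≡ x = subst (λ k → x ∈ park (applyUpTo letter n) ⇔ (x ∈ S × q x ℕ.< k)) (sym (proj₂ (nodeOfRank-spec n<))) (mk⇔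
          (λ x∈ → let x∈S , q≤ = to (parked x) x∈ in x∈S , s≤s q≤)
          (λ { (x∈S , s≤s q≤) → from (parked x) (x∈S , q≤) }))

        -- The gap is found in `Q` while the condition is given for `P`; the common shape carries
        -- the node and its interval across.
        M-letter : NodeAt (shape Q) i → M (park (applyUpTo letter n)) (label P i i∈P) ≡ i
        M-letter nd = allowed⇒M (maximalGap Q decr block subtree l r interval X≡)
          (condition t u blockP (⊑-resp-≈ {shape Q} {shape P} Q≈P block blockP subtree) l r interval i∈P)
          where
          open NodeAt nd
          blockP : IsBlock (support (shape P)) t u
          blockP = subst (λ S → IsBlock S t u) (sym (proj₁ P≈Q)) block
          Q≈P : shape Q ≈ shape P
          Q≈P = sym (proj₁ P≈Q) , λ t u b c → sym (proj₂ P≈Q t u c b)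

      ls-letter : ls 𝒫 (applyUpTo letter n) (letter n) ≡ nodeOfRank n
      ls-letter = trans (ls≡M (applyUpTo letter n) (letter n))
        (trans (cong (M (park (applyUpTo letter n))) (labelAt-≡ P (+ 0) i∈P)) (M-letter (nodeAt (shape Q) i∈S)))

    -- Induction on `n`: the induction hypothesis identifies the occupied set, which by `ls-letter`
    -- determines that the next car parks on the node labeled `suc n`.
    parked : ∀ n → n ℕ.≤ ∣ S ∣ → Parked n
    parked zero _ x = mk⇔ (λ x∈ → contradiction x∈ ∉park-ε)
      (λ (x∈S , q≤0) → contradiction (ℕ.≤-trans (proj₁ (q-range x∈S)) q≤0) λ ())
    parked (suc n) n< x = subst (λ V → x ∈ park V ⇔ (x ∈ S × q x ℕ.≤ suc n)) (applyUpTo-∷ʳ letter n) (mk⇔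
      ([ (λ x∈ → let x∈S , q≤n = to (ih x) x∈ in x∈S , ℕ.m≤n⇒m≤1+n q≤n)
       , (λ x≡ → newest (trans x≡ (ls-letter n< ih)))
       ]′ ∘ to (park-∷ʳ (applyUpTo letter n) (letter n) x))
      (λ (x∈S , q≤1+n) → from (park-∷ʳ (applyUpTo letter n) (letter n) x)
         ([ (λ q<1+n → inj₁ (from (ih x) (x∈S , ℕ.s≤s⁻¹ q<1+n)))
          , (λ q≡ → inj₂ (trans (≡nodeOfRank x∈S n< q≡) (sym (ls-letter n< ih))))
          ]′ (ℕ.m≤n⇒m<n∨m≡n q≤1+n))))
      where
      ih : Parked n
      ih = parked n (ℕ.<⇒≤ n<)
      newest : x ≡ nodeOfRank n → x ∈ S × q x ℕ.≤ suc n
      newest x≡ = subst (_∈ S) (sym x≡) (proj₁ (nodeOfRank-spec n<)) ,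
                  ℕ.≤-reflexive (trans (cong q x≡) (proj₂ (nodeOfRank-spec n<)))

    word : Word
    word = applyUpTo letter ∣ S ∣

    private
      indexOf : ∀ {n} → n ℕ.< ∣ S ∣ → Fin (length word)
      indexOf n< = Fin.fromℕ< (ℕ.<-≤-trans n< (ℕ.≤-reflexive (sym (length-applyUpTo letter ∣ S ∣))))

      toℕ-indexOf : ∀ {n} (n< : n ℕ.< ∣ S ∣) → toℕ (indexOf n<) ≡ n
      toℕ-indexOf n< = Fin.toℕ-fromℕ< _

      lookup-indexOf : ∀ {n} (n< : n ℕ.< ∣ S ∣) → lookup word (indexOf n<) ≡ letter n
      lookup-indexOf n< = trans (lookup-applyUpTo letter ∣ S ∣ _) (cong letter (toℕ-indexOf n<))

      prefix-indexOf : ∀ {n} (n< : n ℕ.< ∣ S ∣) → take (toℕ (indexOf n<)) word ≡ applyUpTo letter n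
      prefix-indexOf n< = trans (cong (λ k → take k word) (toℕ-indexOf n<)) (take-applyUpTo letter (ℕ.<⇒≤ n<))

      outcome : ∀ {n} → n ℕ.< ∣ S ∣ → Outcome 𝒫 word (nodeOfRank n) (suc n)
      outcome n< = indexOf n< ,
        trans (cong₂ (ls 𝒫) (prefix-indexOf n<) (lookup-indexOf n<)) (ls-letter n< (parked _ (ℕ.<⇒≤ n<))) ,
        cong suc (sym (toℕ-indexOf n<))

      letterAt : ∀ {n} → n ℕ.< ∣ S ∣ → LetterAt word (suc n) (letter n)
      letterAt n< = indexOf n< , cong suc (sym (toℕ-indexOf n<)) , sym (lookup-indexOf n<)

      rankOf : ∀ {i} → i ∈ S → ∃ λ n → n ℕ.< ∣ S ∣ × q i ≡ suc n × i ≡ nodeOfRank n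
      rankOf {i} i∈ with q i in q≡ | q-range i∈
      ... | suc n | _ , n< = n , n< , refl , ≡nodeOfRank i∈ n< q≡

    labelCondition⇒image : InImage 𝒫 P Q
    labelCondition⇒image = word , record
      { Q-decreasing = decr
      ; Q-support    = Finℤ-ext S (park word) λ x → mk⇔
          (λ x∈ → from (parked ∣ S ∣ ℕ.≤-refl x) (x∈ , proj₂ (q-range x∈)))
          (proj₁ ∘ to (parked ∣ S ∣ ℕ.≤-refl x))
      ; Q-label      = λ i h → let i∈ = recompute (i ∈? S) h
                                   n , n< , q≡ , i≡ = rankOf i∈
          in subst₂ (Outcome 𝒫 word) (sym i≡) (trans (sym q≡) (labelAt-≡ Q 0 i∈)) (outcome n<)
      ; same-shape   = P≈Q
      ; P-label      = λ i h k → let i∈ = recompute (i ∈? S) k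
                                     n , n< , q≡ , i≡ = rankOf i∈
          in subst₂ (LetterAt word) (trans (sym q≡) (labelAt-≡ Q 0 i∈))
                    (trans (cong p (sym i≡)) (labelAt-≡ P (+ 0) h)) (letterAt n<)
      }

proposition5p5 : (𝒫 : ParkingProcedure) → Bilateral 𝒫 → LocallyDecided 𝒫 → Memoryless 𝒫 →
    GoodCorrespondence 𝒫 ×
    (∀ (P : LabeledForest ℤ) → (∃ λ Q → InImage 𝒫 P Q) ⇔ LabelCondition 𝒫 P)
proposition5p5 𝒫 bilateral local memoryless =
  -- The condition extracted by means of `Q` involves only `P`, so it can be fed to the construction
  -- with `Q′`.
  (λ P Q Q′ (W , m) decr Q≈Q′ → labelCondition⇒image (image⇒labelCondition m) decr
     (≈-trans {shape P} {shape Q} {shape Q′} (_↦_,_.same-shape m) Q≈Q′)) ,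
  λ P → mk⇔ (λ (Q , W , m) → image⇒labelCondition m)
            (λ condition → decreasingForest (shape P) ,
               labelCondition⇒image condition (decreasingForest-decreasing (shape P)) (refl , λ t u b c → refl))
  where open Correspondence 𝒫 bilateral local memoryless
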